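{- A (finite, connected) square grid graph is $F$-avoiding if and only if it is $12$-representable.
   Context: The grid graph is the infinite graph with vertex set $\mathbb{Z}^2$ in which two vertices are adjacent iff they are at Euclidean distance $1$. A square of an induced subgraph $H$ of the grid graph is a set of four vertices of $H$ of the form $\{(x,y),(x+1,y),(x,y+1),(x+1,y+1)\}$ (inducing a $4$-cycle). A square grid graph is a finite connected induced subgraph of the grid graph that consists of squares, i.e. every vertex and every edge of it lies in some square of it. A labeled graph is a graph whose vertices are distinct positive integers. A word $w$ over positive integers with set of letters $A(w)$, and for $B\subseteq A(w)$, $w_B$ denotes the subword of $w$ consisting of the letters in $B$. A labeled graph $G=(V,E)$ is $12$-representable if there is a word $w$ with $A(w)=V$ such that for all distinct $x,y\in V$: $xy\notin E$ if and only if $w_{\{x,y\}}$ contains an occurrence of the pattern $12$, i.e. some occurrence of $\min(x,y)$ precedes some occurrence of $\max(x,y)$ in $w$; such $w$ is called a ($12$-)representant of $G$. An unlabeled graph is $12$-representable if it admits a labeling (injective assignment of positive integers to vertices) making the resulting labeled graph $12$-representable. Let $X$ be the graph with vertices $a,b,c,d,e,f,g,h,i$ and edges $ab, bc, cd, de, ef, fc, bg, gf, gh, hi, if$ (equivalently, the induced subgraph of the grid on $b=(0,0),c=(0,1),d=(0,2),e=(1,2),f=(1,1),g=(1,0),h=(2,0),i=(2,1),a=(-1,0)$: three squares in an L-shape plus a pendant edge $ab$). Let $C_m$ denote the cycle graph on $m$ vertices, and $F=\{X\}\cup\{C_{2n}: n\ge 4\}$. A graph is $F$-avoiding if it contains no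 induced subgraph isomorphic to a member of $F$. -}

module Defs where

open import Data.Nat using (ℕ; zero; suc; _≤_; _<_; _*_; _⊓_; _⊔_)
open import Data.Integer using (ℤ; _+_; 1ℤ)
open import Data.Fin using (Fin; toℕ)
import Data.Fin as Fin
open import Data.List using (List; []; _∷_; length; lookup)
open import Data.List.Membership.Propositional using (_∈_)
open import Data.Product using (Σ; ∃; ∃-syntax; _×_; _,_)
open import Data.Sum using (_⊎_)
open import Relation.Nullary using (¬_)
open import Relation.Binary.PropositionalEquality using (_≡_; _≢_)
open import Function.Bundles using (_⇔_)

Point : Set
Point = ℤ × ℤ

GAdj : Point → Point → Set
GAdj (x , y) (x' , y') =
  (x' ≡ x + 1ℤ × y' ≡ y) ⊎ (x ≡ x' + 1ℤ × y ≡ y') ⊎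
  (x' ≡ x × y' ≡ y + 1ℤ) ⊎ (x ≡ x' × y ≡ y' + 1ℤ)

-- A finite vertex set S ⊆ ℤ² is given as a list (duplicates irrelevant);
-- the graph in question is the induced subgraph of the grid on S.

Corner : Point → Point → Set
Corner (x , y) p =
  (p ≡ (x , y)) ⊎ (p ≡ (x + 1ℤ , y)) ⊎ (p ≡ (x , y + 1ℤ)) ⊎ (p ≡ (x + 1ℤ , y + 1ℤ))

IsSquare : List Point → Point → Set
IsSquare S c = ∀ p → Corner c p → p ∈ S

data Walk (S : List Point) : Point → Point → Set where
  here  : ∀ {p} → Walk S p p
  there : ∀ {p q r} → GAdj p q → q ∈ S → Walk S q r → Walk S p r

Connected : List Point → Set
Connected S = ∀ p q → p ∈ S → q ∈ S → Walk S p q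

ConsistsOfSquares : List Point → Set
ConsistsOfSquares S =
  (∀ p → p ∈ S → ∃[ c ] (IsSquare S c × Corner c p)) ×
  (∀ p q → p ∈ S → q ∈ S → GAdj p q →
     ∃[ c ] (IsSquare S c × Corner c p × Corner c q))

SquareGridGraph : List Point → Set
SquareGridGraph S = Connected S × ConsistsOfSquares S

record FinGraph : Set₁ where
  field
    size : ℕ
    Adj  : Fin size → Fin size → Set
open FinGraph public

ContainsInduced : List Point → FinGraph → Set
ContainsInduced S G =
  Σ (Fin (size G) → Point) λ f → ((∀ i → f i ∈ S) ×
          (∀ i j → f i ≡ f j → i ≡ j) ×
          (∀ i j → i ≢ j → (Adj G i j ⇔ GAdj (f i) (f j))))

-- The graph X: a=0,b=1,c=2,d=3,e=4,f=5,g=6,h=7,i=8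
XEdges : List (ℕ × ℕ)
XEdges = (0 , 1) ∷ (1 , 2) ∷ (2 , 3) ∷ (3 , 4) ∷ (4 , 5) ∷ (5 , 2) ∷
         (1 , 6) ∷ (6 , 5) ∷ (6 , 7) ∷ (7 , 8) ∷ (8 , 5) ∷ []

XGraph : FinGraph
XGraph = record
  { size = 9
  ; Adj  = λ i j → ((toℕ i , toℕ j) ∈ XEdges) ⊎ ((toℕ j , toℕ i) ∈ XEdges) }

CNext : (m : ℕ) → Fin m → Fin m → Set
CNext m i j = (suc (toℕ i) ≡ toℕ j) ⊎ (suc (toℕ i) ≡ m × toℕ j ≡ 0)

Cycle : ℕ → FinGraph
Cycle m = record { size = m ; Adj = λ i j → CNext m i j ⊎ CNext m j i }

FAvoiding : List Point → Set
FAvoiding S =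
  ¬ ContainsInduced S XGraph ×
  (∀ n → 4 ≤ n → ¬ ContainsInduced S (Cycle (2 * n)))

Occ12 : List ℕ → ℕ → ℕ → Set
Occ12 w a b = ∃[ i ] ∃[ j ] (i Fin.< j × lookup w i ≡ a × lookup w j ≡ b)

-- w_{x,y} contains the pattern 12
Has12 : List ℕ → ℕ → ℕ → Set
Has12 w x y = Occ12 w (x ⊓ y) (x ⊔ y)

Represents : List Point → (Point → ℕ) → List ℕ → Set
Represents S ℓ w =
  (∀ a → a ∈ w → ∃[ p ] (p ∈ S × ℓ p ≡ a)) ×
  (∀ p → p ∈ S → ℓ p ∈ w) ×
  (∀ p q → p ∈ S → q ∈ S → p ≢ q →
     ((¬ GAdj p q) ⇔ Has12 w (ℓ p) (ℓ q)))

IsLabeling : List Point → (Point → ℕ) → Set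
IsLabeling S ℓ =
  (∀ p → p ∈ S → 0 < ℓ p) ×
  (∀ p q → p ∈ S → q ∈ S → ℓ p ≡ ℓ q → p ≡ q)

TwelveRepresentable : List Point → Set
TwelveRepresentable S =
  ∃[ ℓ ] (IsLabeling S ℓ × ∃[ w ] Represents S ℓ w)

{-# OPTIONS --safe #-}
-- In an F-avoiding square grid graph the absence of X and C₈ leaves every unit
-- square with at most two neighbours (squares sharing an edge with it, or
-- sharing a vertex that lies in no third square).  Squares arranged in a ring
-- would give a closed walk crossing a seam an odd number of times, and a
-- shortest such walk is an induced cycle of length at least 8.  Hence the
-- squares form a path, every vertex lies in an interval of consecutive
-- squares, and two vertices are adjacent iff their parities differ and their
-- intervals meet; this pair of inequalities is encoded by the labels and the word.
-- Conversely, for vertices of opposite parity in a 12-representable graph the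
-- reason for nonadjacency (label or position) behaves like a left/right
-- relation that is preserved when both vertices move along edges to another
-- nonadjacent pair; long cycles and X allow a pair to return with its sides exchanged.
module Submission where

open import Defs
open import Data.Bool using (Bool; true; false; not; _xor_; _∧_; if_then_else_)
import Data.Bool.Properties as Boolₚ
open import Data.Bool.Solver using (module xor-∧-Solver)
open Boolₚ using (xor-assoc; xor-comm; xor-same; xor-identityʳ; not-involutive)
open import Data.Empty using (⊥; ⊥-elim)
open import Data.Fin as Fin using (Fin; toℕ; fromℕ<; #_)
import Data.Fin.Properties as Finₚ
open import Data.Integer using (ℤ; +_; -[1+_]; _+_; -_; 0ℤ; 1ℤ; -1ℤ)
import Data.Integer as ℤ
import Data.Integer.Properties as ℤₚ
open import Data.List using (List; []; _∷_; _++_; map; concatMap; filter; length)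
import Data.List.Properties as Listₚ
import Data.List.Sort as Sort
open import Data.List.Membership.Propositional using (_∈_; find; lose)
open import Data.List.Membership.Propositional.Properties
  using (∈-filter⁺; ∈-filter⁻; ∈-++⁺ˡ; ∈-++⁺ʳ; ∈-++⁻; ∈-map⁺; ∈-map⁻; ∈-lookup)
open import Data.List.Relation.Binary.Permutation.Propositional using (↭-sym)
open import Data.List.Relation.Binary.Permutation.Propositional.Properties using (∈-resp-↭)
open import Data.List.Relation.Unary.All using (All; []; _∷_)
import Data.List.Relation.Unary.All as All
open import Data.List.Relation.Unary.AllPairs using (AllPairs; []; _∷_)
open import Data.List.Relation.Unary.Any using (here; there; index)
import Data.List.Relation.Unary.Any as Any
import Data.List.Relation.Unary.Any.Properties as Anyₚ
open Anyₚ using (lookup-index)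
open import Data.List.Relation.Unary.Linked.Properties using (Linked⇒AllPairs)
open import Data.Nat as ℕ using (ℕ; zero; suc; _≤_; _<_; z≤n; s≤s; _∸_; _⊔_; _*_)
open import Data.Nat.Induction using (<-rec)
import Data.Nat.Properties as ℕₚ
open import Data.Nat.Solver using (module +-*-Solver)
open import Data.Product using (Σ; ∃-syntax; _×_; _,_; proj₁; proj₂)
import Data.Product as Product
import Data.Product.Properties as Productₚ
open import Data.Sum using (_⊎_; inj₁; inj₂)
import Data.Sum as Sum
import Data.Vec as Vec
import Data.Vec.Membership.Propositional.Properties as VecMem
open import Function.Bundles using (_⇔_; mk⇔; Equivalence)
open import Relation.Binary using (tri<; tri≈; tri>; DecTotalOrder)
import Relation.Binary.Construct.On as On
open import Relation.Binary.PropositionalEquality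
open import Relation.Nullary using (¬_; Dec; yes; no; contradiction; does)
open import Relation.Nullary.Decidable
  using (_×-dec_; _⊎-dec_; _→-dec_; ¬?; map′; toWitness; True; dec-true; dec-false; decidable-stable)

-- The obstacle is global: no local condition stops the squares from closing up around a hole.
-- Instead of planarity, the proof uses cochains mod 2. A function on edges that has a potential on
-- each unit square has total zero on every closed walk that can be cut into backtracks and unit
-- squares. Cutting at repeated vertices and chords stops only at induced cycles. The grid is
-- bipartite, so lengths are even; a closed walk of length 4 without repetition runs round a unit
-- square, and one of length 6 always has a chord or a repetition. This is why the forbidden cycles
-- start at length 8. C₈ also acts locally, as the ring around a vertex lying in four squares.
-- Squares that meet in a single vertex have to count as neighbours because the graph may hang
-- together at a cut vertex. Local geometry is translated to the origin and decided by evaluation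
-- over finitely many offsets.

-- Translations, adjacency, parity and corners in the grid.

infixl 6 _⊕_
_⊕_ : Point → Point → Point
(x , y) ⊕ (u , v) = x + u , y + v

⊖_ : Point → Point
⊖ (x , y) = - x , - y

𝟎 : Point
𝟎 = 0ℤ , 0ℤ

⊕-assoc : ∀ p q r → (p ⊕ q) ⊕ r ≡ p ⊕ (q ⊕ r)
⊕-assoc (a , b) (c , d) (e , f) = cong₂ _,_ (ℤₚ.+-assoc a c e) (ℤₚ.+-assoc b d f)

⊕-comm : ∀ p q → p ⊕ q ≡ q ⊕ p
⊕-comm (a , b) (c , d) = cong₂ _,_ (ℤₚ.+-comm a c) (ℤₚ.+-comm b d)

⊕-identityʳ : ∀ p → p ⊕ 𝟎 ≡ p
⊕-identityʳ (a , b) = cong₂ _,_ (ℤₚ.+-identityʳ a) (ℤₚ.+-identityʳ b)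

⊕-inverseʳ : ∀ p → p ⊕ ⊖ p ≡ 𝟎
⊕-inverseʳ (a , b) = cong₂ _,_ (ℤₚ.+-inverseʳ a) (ℤₚ.+-inverseʳ b)

⊖-⊕ : ∀ c p → ⊖ c ⊕ (c ⊕ p) ≡ p
⊖-⊕ (a , b) (x , y) = cong₂ _,_ (undo a x) (undo b y)
  where
  undo : ∀ a x → - a + (a + x) ≡ x
  undo a x = trans (sym (ℤₚ.+-assoc (- a) a x))
    (trans (cong (_+ x) (ℤₚ.+-inverseˡ a)) (ℤₚ.+-identityˡ x))

⊕-cancelˡ : ∀ p {q r} → p ⊕ q ≡ p ⊕ r → q ≡ r
⊕-cancelˡ p {q} {r} eq = trans (sym (⊖-⊕ p q)) (trans (cong (⊖ p ⊕_) eq) (⊖-⊕ p r))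

⊕-⊖ : ∀ {p q} r → p ≡ q ⊕ r → q ≡ p ⊕ ⊖ r
⊕-⊖ {_} {q} r refl = sym (trans (⊕-assoc q r (⊖ r)) (trans (cong (q ⊕_) (⊕-inverseʳ r)) (⊕-identityʳ q)))

infix 4 _≟_ _∈?_
_≟_ : (p q : Point) → Dec (p ≡ q)
_≟_ = Productₚ.≡-dec ℤ._≟_ ℤ._≟_

_∈?_ : ∀ p (S : List Point) → Dec (p ∈ S)
p ∈? S = Any.any? (p ≟_) S

GAdj? : ∀ p q → Dec (GAdj p q)
GAdj? (x , y) (x' , y') =
  (x' ℤ.≟ x + 1ℤ ×-dec y' ℤ.≟ y) ⊎-dec (x ℤ.≟ x' + 1ℤ ×-dec y ℤ.≟ y') ⊎-dec
  (x' ℤ.≟ x ×-dec y' ℤ.≟ y + 1ℤ) ⊎-dec (x ℤ.≟ x' ×-dec y ℤ.≟ y' + 1ℤ)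

GAdj-sym : ∀ {p q} → GAdj p q → GAdj q p
GAdj-sym (inj₁ h) = inj₂ (inj₁ h)
GAdj-sym (inj₂ (inj₁ h)) = inj₁ h
GAdj-sym (inj₂ (inj₂ (inj₁ h))) = inj₂ (inj₂ (inj₂ h))
GAdj-sym (inj₂ (inj₂ (inj₂ h))) = inj₂ (inj₂ (inj₁ h))

GAdj-shift : ∀ c {p q} → GAdj p q → GAdj (c ⊕ p) (c ⊕ q)
GAdj-shift (a , b) {x , y} (inj₁ (refl , refl)) = inj₁ (sym (ℤₚ.+-assoc a x 1ℤ) , refl)
GAdj-shift (a , b) {_} {x , y} (inj₂ (inj₁ (refl , refl))) = inj₂ (inj₁ (sym (ℤₚ.+-assoc a x 1ℤ) , refl))
GAdj-shift (a , b) {x , y} (inj₂ (inj₂ (inj₁ (refl , refl)))) = inj₂ (inj₂ (inj₁ (refl , sym (ℤₚ.+-assoc b y 1ℤ))))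
GAdj-shift (a , b) {_} {x , y} (inj₂ (inj₂ (inj₂ (refl , refl)))) = inj₂ (inj₂ (inj₂ (refl , sym (ℤₚ.+-assoc b y 1ℤ))))

GAdj-unshift : ∀ c {p q} → GAdj (c ⊕ p) (c ⊕ q) → GAdj p q
GAdj-unshift c {p} {q} h = subst₂ GAdj (⊖-⊕ c p) (⊖-⊕ c q) (GAdj-shift (⊖ c) h)

units : List Point
units = (1ℤ , 0ℤ) ∷ (-1ℤ , 0ℤ) ∷ (0ℤ , 1ℤ) ∷ (0ℤ , -1ℤ) ∷ []

GAdj⇒unit : ∀ {p q} → GAdj p q → ∃[ δ ] (δ ∈ units × q ≡ p ⊕ δ)
GAdj⇒unit {x , y} (inj₁ (refl , refl)) = (1ℤ , 0ℤ) , here refl , cong (x + 1ℤ ,_) (sym (ℤₚ.+-identityʳ y))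
GAdj⇒unit {p} {q} (inj₂ (inj₁ (refl , refl))) = (-1ℤ , 0ℤ) , there (here refl) ,
  ⊕-⊖ (1ℤ , 0ℤ) (cong₂ _,_ refl (sym (ℤₚ.+-identityʳ (proj₂ q))))
GAdj⇒unit {x , y} (inj₂ (inj₂ (inj₁ (refl , refl)))) = (0ℤ , 1ℤ) , there (there (here refl)) ,
  cong (_, y + 1ℤ) (sym (ℤₚ.+-identityʳ x))
GAdj⇒unit {p} {q} (inj₂ (inj₂ (inj₂ (refl , refl)))) = (0ℤ , -1ℤ) , there (there (there (here refl))) ,
  ⊕-⊖ (0ℤ , 1ℤ) (cong₂ _,_ (sym (ℤₚ.+-identityʳ (proj₁ q))) refl)

parityℕ : ℕ → Bool
parityℕ zero = false
parityℕ (suc n) = not (parityℕ n)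

parityℤ : ℤ → Bool
parityℤ (+ n) = parityℕ n
parityℤ -[1+ n ] = not (parityℕ n)

parityℤ-suc : ∀ x → parityℤ (x + 1ℤ) ≡ not (parityℤ x)
parityℤ-suc (+ n) = cong parityℕ (ℕₚ.+-comm n 1)
parityℤ-suc -[1+ zero ] = refl
parityℤ-suc -[1+ suc n ] = sym (not-involutive _)

parity : Point → Bool
parity (x , y) = parityℤ x xor parityℤ y

parity-adj : ∀ {p q} → GAdj p q → parity q ≡ not (parity p)
parity-adj {x , y} (inj₁ (refl , refl)) rewrite parityℤ-suc x with parityℤ x | parityℤ y
... | false | b = refl
... | true | b = sym (not-involutive b)
parity-adj {_} {x , y} (inj₂ (inj₁ (refl , refl))) rewrite parityℤ-suc x with parityℤ x | parityℤ y
... | false | b = sym (not-involutive b)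
... | true | b = refl
parity-adj {x , y} (inj₂ (inj₂ (inj₁ (refl , refl)))) rewrite parityℤ-suc y with parityℤ x | parityℤ y
... | false | b = refl
... | true | b = refl
parity-adj {_} {x , y} (inj₂ (inj₂ (inj₂ (refl , refl)))) rewrite parityℤ-suc y with parityℤ x | parityℤ y
... | false | b = sym (not-involutive b)
... | true | b = cong not (sym (not-involutive b))

corners : List Point
corners = (0ℤ , 0ℤ) ∷ (1ℤ , 0ℤ) ∷ (0ℤ , 1ℤ) ∷ (1ℤ , 1ℤ) ∷ []

Corner⇒offset : ∀ {c p} → Corner c p → ∃[ γ ] (γ ∈ corners × p ≡ c ⊕ γ)
Corner⇒offset {c} (inj₁ refl) = 𝟎 , here refl , sym (⊕-identityʳ c)
Corner⇒offset {x , y} (inj₂ (inj₁ refl)) = _ , there (here refl) , cong (x + 1ℤ ,_) (sym (ℤₚ.+-identityʳ y))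
Corner⇒offset {x , y} (inj₂ (inj₂ (inj₁ refl))) = _ , there (there (here refl)) , cong (_, y + 1ℤ) (sym (ℤₚ.+-identityʳ x))
Corner⇒offset (inj₂ (inj₂ (inj₂ refl))) = _ , there (there (there (here refl))) , refl

offset⇒Corner : ∀ c {γ} → γ ∈ corners → Corner c (c ⊕ γ)
offset⇒Corner c (here refl) = inj₁ (⊕-identityʳ c)
offset⇒Corner (x , y) (there (here refl)) = inj₂ (inj₁ (cong (x + 1ℤ ,_) (ℤₚ.+-identityʳ y)))
offset⇒Corner (x , y) (there (there (here refl))) = inj₂ (inj₂ (inj₁ (cong (_, y + 1ℤ) (ℤₚ.+-identityʳ x))))
offset⇒Corner c (there (there (there (here refl)))) = inj₂ (inj₂ (inj₂ refl))

Corner? : ∀ c p → Dec (Corner c p)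
Corner? c p = (p ≟ _) ⊎-dec (p ≟ _) ⊎-dec (p ≟ _) ⊎-dec (p ≟ _)

dirs : List Point
dirs = (1ℤ , 0ℤ) ∷ (-1ℤ , 0ℤ) ∷ (0ℤ , 1ℤ) ∷ (0ℤ , -1ℤ) ∷
       (1ℤ , 1ℤ) ∷ (-1ℤ , -1ℤ) ∷ (1ℤ , -1ℤ) ∷ (-1ℤ , 1ℤ) ∷ []

infix 4 _⊆?_
_⊆_ : List Point → List Point → Set
P ⊆ Q = All (_∈ Q) P

_⊆?_ : ∀ P Q → Dec (P ⊆ Q)
P ⊆? Q = All.all? (_∈? Q) P

-- Offsets of the corners of the squares at the given offsets.
cover : List Point → List Point
cover = concatMap (λ δ → map (δ ⊕_) corners)

-- Induced copies of X and C₈, and the finite local checks.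

Induced : (G : FinGraph) → (Fin (size G) → Point) → Set
Induced G o = (∀ i j → o i ≡ o j → i ≡ j) × (∀ i j → i ≢ j → (Adj G i j ⇔ GAdj (o i) (o j)))

_⇔-dec_ : ∀ {A B : Set} → Dec A → Dec B → Dec (A ⇔ B)
a ⇔-dec b = map′ (λ (f , g) → mk⇔ f g) (λ e → Equivalence.to e , Equivalence.from e)
  ((a →-dec b) ×-dec (b →-dec a))

Induced? : ∀ G → (∀ i j → Dec (Adj G i j)) → ∀ o → Dec (Induced G o)
Induced? G adj? o =
  Finₚ.all? (λ i → Finₚ.all? (λ j → (o i ≟ o j) →-dec (i Fin.≟ j))) ×-dec
  Finₚ.all? (λ i → Finₚ.all? (λ j → ¬? (i Fin.≟ j) →-dec (adj? i j ⇔-dec GAdj? (o i) (o j))))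

Induced-shift : ∀ G o c → Induced G o → Induced G (λ i → c ⊕ o i)
Induced-shift G o c (inj , adj) =
  (λ i j eq → inj i j (⊕-cancelˡ c eq)) ,
  (λ i j i≢j → mk⇔ (λ h → GAdj-shift c (Equivalence.to (adj i j i≢j) h))
                    (λ h → Equivalence.from (adj i j i≢j) (GAdj-unshift c h)))

X-adj? : ∀ i j → Dec (Adj XGraph i j)
X-adj? i j = edge? i j ⊎-dec edge? j i
  where
  edge? : ∀ (i j : Fin 9) → Dec ((toℕ i , toℕ j) ∈ XEdges)
  edge? i j = Any.any? (Productₚ.≡-dec ℕ._≟_ ℕ._≟_ (toℕ i , toℕ j)) XEdges

C-adj? : ∀ m i j → Dec (Adj (Cycle m) i j)
C-adj? m i j = next? i j ⊎-dec next? j i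
  where
  next? : ∀ (i j : Fin m) → Dec (CNext m i j)
  next? i j = (suc (toℕ i) ℕ.≟ toℕ j) ⊎-dec ((suc (toℕ i) ℕ.≟ m) ×-dec (toℕ j ℕ.≟ 0))

-- Placed so that the corner square of the L is the square at `𝟎`, which all `symmetries` preserve
-- and which carries the three links in `three-links-check`.
X-points : Fin 9 → Point
X-points = Vec.lookup
  ((-1ℤ , 0ℤ) ∷ (0ℤ , 0ℤ) ∷ (0ℤ , 1ℤ) ∷ (0ℤ , + 2) ∷ (1ℤ , + 2) ∷ (1ℤ , 1ℤ) ∷
   (1ℤ , 0ℤ) ∷ (+ 2 , 0ℤ) ∷ (+ 2 , 1ℤ) ∷ [])
  where open Vec using ([]; _∷_)

-- The eight symmetries of the square with corners 0, 1 in each coordinate.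
symmetries : List (Point → Point)
symmetries = concatMap (λ f → (λ p → f p) ∷ (λ p → mirror (f p)) ∷ [])
    (concatMap (λ f → (λ p → f p) ∷ (λ p → flip (f p)) ∷ [])
      ((λ p → p) ∷ transpose ∷ []))
  where
  mirror flip transpose : Point → Point
  mirror (x , y) = 1ℤ ℤ.- x , y
  flip (x , y) = x , 1ℤ ℤ.- y
  transpose (x , y) = y , x

-- The boundary of the two-by-two block of squares around the origin.
ring : Fin 8 → Point
ring = Vec.lookup
  ((1ℤ , 0ℤ) ∷ (1ℤ , 1ℤ) ∷ (0ℤ , 1ℤ) ∷ (-1ℤ , 1ℤ) ∷ (-1ℤ , 0ℤ) ∷ (-1ℤ , -1ℤ) ∷
   (0ℤ , -1ℤ) ∷ (1ℤ , -1ℤ) ∷ [])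
  where open Vec using ([]; _∷_)

abstract
  X-induced : All (λ τ → Induced XGraph (λ i → τ (X-points i))) symmetries
  X-induced = toWitness {a? = All.all? (λ τ → Induced? XGraph X-adj? (λ i → τ (X-points i))) symmetries} _

abstract
  ring-induced : Induced (Cycle 8) ring
  ring-induced = toWitness {a? = Induced? (Cycle 8) (C-adj? 8) ring} _

points : ∀ {n} → (Fin n → Point) → List Point
points o = Vec.toList (Vec.tabulate o)

-- Refutes a link from `𝟎` to some `δ`: all corners of the square at `ε` lie in `P`, so that square
-- is present and separates the two.
Blocked : List Point → List Point → Set
Blocked P δs = Any.Any (λ δ → Any.Any (λ ε → GAdj ε δ × cover (ε ∷ []) ⊆ P) units) δs

abstract
  -- Three distinct links at one square cannot exist: the four squares contain a
  -- copy of X, or the corners of a square separating one of the links.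
  three-links-check :
    All (λ δ₁ → All (λ δ₂ → All (λ δ₃ →
      δ₁ ≡ δ₂ ⊎ δ₁ ≡ δ₃ ⊎ δ₂ ≡ δ₃ ⊎
      Blocked (cover (𝟎 ∷ δ₁ ∷ δ₂ ∷ δ₃ ∷ [])) (δ₁ ∷ δ₂ ∷ δ₃ ∷ []) ⊎
      Any.Any (λ τ → All (_∈ cover (𝟎 ∷ δ₁ ∷ δ₂ ∷ δ₃ ∷ [])) (points (λ i → τ (X-points i)))) symmetries)
      dirs) dirs) dirs
  three-links-check = toWitness {a? = All.all? (λ δ₁ → All.all? (λ δ₂ → All.all? (λ δ₃ →
      (δ₁ ≟ δ₂) ⊎-dec (δ₁ ≟ δ₃) ⊎-dec (δ₂ ≟ δ₃) ⊎-dec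
      Any.any? (λ δ → Any.any? (λ ε → GAdj? ε δ ×-dec (cover (ε ∷ []) ⊆? _)) units) (δ₁ ∷ δ₂ ∷ δ₃ ∷ []) ⊎-dec
      Any.any? (λ τ → _ ⊆? _) symmetries)
      dirs) dirs) dirs} _

abstract
  within-square-check :
    All (λ γ → All (λ γ' → GAdj γ γ' ⊎ Any.Any (λ β → GAdj γ β × GAdj β γ') corners) corners) corners
  within-square-check = toWitness {a? = All.all? (λ γ → All.all? (λ γ' →
    GAdj? γ γ' ⊎-dec Any.any? (λ β → GAdj? γ β ×-dec GAdj? β γ') corners) corners) corners} _

abstract
  touching-check : All (λ γ → All (λ γ' → γ ⊕ ⊖ γ' ∈ 𝟎 ∷ dirs) corners) corners
  touching-check = toWitness {a? = All.all? (λ γ → All.all? (λ γ' → γ ⊕ ⊖ γ' ∈? 𝟎 ∷ dirs) corners) corners} _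

abstract
  -- Here `δ` is two unit steps from `𝟎`, hence diagonal, and the only vertex common to the squares
  -- at `𝟎` and `δ` also lies on the square between them.
  blocker-check : All (λ ε → All (λ δ → All (λ γ → All (λ γ' →
    GAdj ε δ → γ ≡ δ ⊕ γ' → Any.Any (λ β → γ ≡ ε ⊕ β) corners) corners) corners) dirs) units
  blocker-check = toWitness {a? = All.all? (λ ε → All.all? (λ δ → All.all? (λ γ → All.all? (λ γ' →
    GAdj? ε δ →-dec ((γ ≟ δ ⊕ γ') →-dec Any.any? (λ β → γ ≟ ε ⊕ β) corners)) corners) corners) dirs) units} _

abstract
  -- `⊖ γ` is the square that has the origin as its corner `γ`; four different ones fill the block
  -- around the origin.
  four-squares-check : All (λ γ₁ → All (λ γ₂ → All (λ γ₃ → All (λ γ₄ →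
    Any.Any (λ (γ , γ') → γ ≡ γ') ((γ₁ , γ₂) ∷ (γ₁ , γ₃) ∷ (γ₁ , γ₄) ∷ (γ₂ , γ₃) ∷ (γ₂ , γ₄) ∷ (γ₃ , γ₄) ∷ []) ⊎
    points ring ⊆ cover (⊖ γ₁ ∷ ⊖ γ₂ ∷ ⊖ γ₃ ∷ ⊖ γ₄ ∷ [])) corners) corners) corners) corners
  four-squares-check = toWitness {a? = All.all? (λ γ₁ → All.all? (λ γ₂ → All.all? (λ γ₃ → All.all? (λ γ₄ →
    Any.any? (λ (γ , γ') → γ ≟ γ') _ ⊎-dec (points ring ⊆? _)) corners) corners) corners) corners} _

abstract
  -- Three pairwise touching squares fit in a two-by-two block, so one of them shares an edge with
  -- each of the other two.
  triangle-check : All (λ δ₁ → All (λ δ₂ → δ₂ ⊕ ⊖ δ₁ ∈ dirs →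
    (GAdj 𝟎 δ₁ × GAdj δ₁ δ₂) ⊎ (GAdj 𝟎 δ₂ × GAdj δ₂ δ₁) ⊎ (GAdj δ₁ 𝟎 × GAdj 𝟎 δ₂)) dirs) dirs
  triangle-check = toWitness {a? = All.all? (λ δ₁ → All.all? (λ δ₂ → (δ₂ ⊕ ⊖ δ₁ ∈? dirs) →-dec
    ((GAdj? 𝟎 δ₁ ×-dec GAdj? δ₁ δ₂) ⊎-dec (GAdj? 𝟎 δ₂ ×-dec GAdj? δ₂ δ₁) ⊎-dec (GAdj? δ₁ 𝟎 ×-dec GAdj? 𝟎 δ₂))) dirs) dirs} _

abstract
  -- The offsets are partial sums of the steps. Without a repetition the walk runs round a unit
  -- square, in which its start is the corner `γ`; the square itself is then at `⊖ γ`.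
  four-cycle-check : All (λ δ₁ → All (λ δ₂ → All (λ δ₃ →
    GAdj (δ₁ ⊕ δ₂ ⊕ δ₃) 𝟎 →
    (δ₁ ⊕ δ₂ ≡ 𝟎) ⊎ (δ₁ ⊕ δ₂ ⊕ δ₃ ≡ δ₁) ⊎
    Any.Any (λ γ → All (λ β → Any.Any (λ ε → ⊖ γ ⊕ β ≡ ε) (𝟎 ∷ δ₁ ∷ δ₁ ⊕ δ₂ ∷ δ₁ ⊕ δ₂ ⊕ δ₃ ∷ [])) corners ×
                    All (λ ε → γ ⊕ ε ∈ corners) (𝟎 ∷ δ₁ ∷ δ₁ ⊕ δ₂ ∷ δ₁ ⊕ δ₂ ⊕ δ₃ ∷ [])) corners)
    units) units) units
  four-cycle-check = toWitness {a? = All.all? (λ δ₁ → All.all? (λ δ₂ → All.all? (λ δ₃ →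
    GAdj? (δ₁ ⊕ δ₂ ⊕ δ₃) 𝟎 →-dec
    ((δ₁ ⊕ δ₂ ≟ 𝟎) ⊎-dec (δ₁ ⊕ δ₂ ⊕ δ₃ ≟ δ₁) ⊎-dec
    Any.any? (λ γ → All.all? (λ β → Any.any? (λ ε → ⊖ γ ⊕ β ≟ ε) _) corners ×-dec
                    All.all? (λ ε → γ ⊕ ε ∈? corners) _) corners))
    units) units) units} _

abstract
  -- A closed 6-walk without repetition bounds a domino, whose middle edge joins antipodal vertices.
  -- The first vertex equalling the fifth, or the second the sixth, is not listed: it leaves a
  -- closed 4-walk, which again gives an antipodal edge.
  hexagon-check : All (λ δ₁ → All (λ δ₂ → All (λ δ₃ → All (λ δ₄ → All (λ δ₅ →
    GAdj (δ₁ ⊕ δ₂ ⊕ δ₃ ⊕ δ₄ ⊕ δ₅) 𝟎 →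
    δ₁ ⊕ δ₂ ≡ 𝟎 ⊎ δ₁ ⊕ δ₂ ⊕ δ₃ ≡ δ₁ ⊎ δ₁ ⊕ δ₂ ⊕ δ₃ ⊕ δ₄ ≡ δ₁ ⊕ δ₂ ⊎
    δ₁ ⊕ δ₂ ⊕ δ₃ ⊕ δ₄ ⊕ δ₅ ≡ δ₁ ⊕ δ₂ ⊕ δ₃ ⊎
    GAdj 𝟎 (δ₁ ⊕ δ₂ ⊕ δ₃) ⊎ GAdj δ₁ (δ₁ ⊕ δ₂ ⊕ δ₃ ⊕ δ₄) ⊎ GAdj (δ₁ ⊕ δ₂) (δ₁ ⊕ δ₂ ⊕ δ₃ ⊕ δ₄ ⊕ δ₅))
    units) units) units) units) units
  hexagon-check = toWitness {a? = All.all? (λ δ₁ → All.all? (λ δ₂ → All.all? (λ δ₃ → All.all? (λ δ₄ → All.all? (λ δ₅ →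
    GAdj? _ _ →-dec (_ ≟ _ ⊎-dec _ ≟ _ ⊎-dec _ ≟ _ ⊎-dec _ ≟ _ ⊎-dec
    GAdj? _ _ ⊎-dec GAdj? _ _ ⊎-dec GAdj? _ _))
    units) units) units) units) units} _

points-∈ : ∀ {n} (o : Fin n → Point) i → o i ∈ points o
points-∈ o i = VecMem.∈-toList⁺ (VecMem.∈-tabulate⁺ o i)

GAdj⇒≢ : ∀ {p q} → GAdj p q → p ≢ q
GAdj⇒≢ {p} h refl = lemma (parity p) (parity-adj h)
  where
  lemma : ∀ b → b ≢ not b
  lemma false ()
  lemma true ()

no-triangle : ∀ {p q r} → GAdj p q → GAdj q r → ¬ GAdj p r
no-triangle {p} {q} {r} h k l = lemma (parity p) (parity q) (parity r) (parity-adj h) (parity-adj k) (parity-adj l)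
  where
  lemma : ∀ a b c → b ≡ not a → c ≡ not b → c ≢ not a
  lemma false true false _ _ ()
  lemma true false true _ _ ()

GAdj-from : ∀ c {δ} → GAdj 𝟎 δ → GAdj c (c ⊕ δ)
GAdj-from c {δ} h = subst (λ z → GAdj z (c ⊕ δ)) (⊕-identityʳ c) (GAdj-shift c h)

GAdj-unit : ∀ c {δ} → δ ∈ units → GAdj c (c ⊕ δ)
GAdj-unit c δ∈ = GAdj-from c (All.lookup 𝟎-units δ∈)
  where
  𝟎-units : All (GAdj 𝟎) units
  𝟎-units = toWitness {a? = All.all? (GAdj? 𝟎) units} _

unit⇒dir : ∀ {δ} → δ ∈ units → δ ∈ dirs
unit⇒dir = ∈-++⁺ˡ {xs = units}

-- The second alternative covers `p ≡ q` as well as opposite corners.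
within-square : ∀ {c p q} → Corner c p → Corner c q →
  GAdj p q ⊎ ∃[ r ] (Corner c r × GAdj p r × GAdj r q)
within-square {c} hp hq with Corner⇒offset hp | Corner⇒offset hq
... | γ , γ∈ , refl | γ' , γ'∈ , refl with All.lookup (All.lookup within-square-check γ∈) γ'∈
...   | inj₁ h = inj₁ (GAdj-shift c h)
...   | inj₂ h with find h
...     | β , β∈ , h₁ , h₂ = inj₂ (c ⊕ β , offset⇒Corner c β∈ , GAdj-shift c h₁ , GAdj-shift c h₂)

touching : ∀ {c d p} → Corner c p → Corner d p → d ≡ c ⊎ ∃[ δ ] (δ ∈ dirs × d ≡ c ⊕ δ)
touching {c} {d} hp hq with Corner⇒offset hp | Corner⇒offset hq
... | γ , γ∈ , refl | γ' , γ'∈ , eq = go (All.lookup (All.lookup touching-check γ∈) γ'∈)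
  where
  d≡ : d ≡ c ⊕ (γ ⊕ ⊖ γ')
  d≡ = trans (⊕-⊖ γ' eq) (⊕-assoc c γ (⊖ γ'))
  go : γ ⊕ ⊖ γ' ∈ 𝟎 ∷ dirs → d ≡ c ⊎ ∃[ δ ] (δ ∈ dirs × d ≡ c ⊕ δ)
  go (here eq₀) = inj₁ (trans d≡ (trans (cong (c ⊕_) eq₀) (⊕-identityʳ c)))
  go (there m) = inj₂ (_ , m , d≡)

cover-lookup : ∀ {Q : Point → Set} δs → (∀ {δ} → δ ∈ δs → ∀ {γ} → γ ∈ corners → Q (δ ⊕ γ)) →
  ∀ {p} → p ∈ cover δs → Q p
cover-lookup (δ ∷ δs) h m with ∈-++⁻ (map (δ ⊕_) corners) m
... | inj₁ m' with ∈-map⁻ (δ ⊕_) m'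
...   | γ , γ∈ , refl = h (here refl) γ∈
cover-lookup (δ ∷ δs) h m | inj₂ m' = cover-lookup δs (λ k → h (there k)) m'

-- Unit squares, links between them, and the bound of two links per square.

module Squares (S : List Point) where

  Square : Point → Set
  Square = IsSquare S

  square-∈ : ∀ {c} → Square c → ∀ {γ} → γ ∈ corners → c ⊕ γ ∈ S
  square-∈ {c} sq γ∈ = sq _ (offset⇒Corner c γ∈)

  ∈-square : ∀ {c} → (∀ {γ} → γ ∈ corners → c ⊕ γ ∈ S) → Square c
  ∈-square {c} h p hp with Corner⇒offset {c} hp
  ... | γ , γ∈ , refl = h γ∈

  Square? : ∀ c → Dec (Square c)
  Square? c = map′ (λ h → ∈-square (All.lookup h)) (λ sq → All.tabulate (square-∈ sq))
    (All.all? (λ γ → c ⊕ γ ∈? S) corners)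

  squares : List Point
  squares = filter Square? S

  Square⇒∈ : ∀ {c} → Square c → c ∈ squares
  Square⇒∈ {c} sq = ∈-filter⁺ Square? (sq c (inj₁ refl)) sq

  covered-∈ : ∀ c {δs} → (∀ {δ} → δ ∈ δs → Square (c ⊕ δ)) → ∀ {p} → p ∈ cover δs → c ⊕ p ∈ S
  covered-∈ c {δs} h = cover-lookup {Q = λ p → c ⊕ p ∈ S} δs λ {δ} δ∈ {γ} γ∈ →
    subst (_∈ S) (⊕-assoc c δ γ) (square-∈ (h δ∈) γ∈)

  -- Two squares sharing an edge are never separated by a third one; two
  -- squares sharing one vertex are linked iff no further square contains it.
  Link : Point → Point → Set
  Link c d = Square c × Square d × (∃[ δ ] (δ ∈ dirs × d ≡ c ⊕ δ)) ×
    ¬ (∃[ e ] (Square e × GAdj c e × GAdj e d))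

  Separated? : ∀ c d → Dec (∃[ e ] (Square e × GAdj c e × GAdj e d))
  Separated? c d = map′ to from
    (Any.any? (λ ε → Square? (c ⊕ ε) ×-dec GAdj? (c ⊕ ε) d) units)
    where
    to : Any.Any (λ ε → Square (c ⊕ ε) × GAdj (c ⊕ ε) d) units → ∃[ e ] (Square e × GAdj c e × GAdj e d)
    to h with find h
    ... | ε , ε∈ , sq , adj = c ⊕ ε , sq , GAdj-unit c ε∈ , adj
    from : ∃[ e ] (Square e × GAdj c e × GAdj e d) → Any.Any (λ ε → Square (c ⊕ ε) × GAdj (c ⊕ ε) d) units
    from (e , sq , adj , adj') with GAdj⇒unit {c} {e} adj
    ... | ε , ε∈ , refl = lose ε∈ (sq , adj')

  Link? : ∀ c d → Dec (Link c d)
  Link? c d = Square? c ×-dec Square? d ×-dec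
    map′ find (λ (δ , δ∈ , eq) → lose δ∈ eq) (Any.any? (λ δ → d ≟ c ⊕ δ) dirs) ×-dec ¬? (Separated? c d)

  neg-dir : ∀ {δ} → δ ∈ dirs → ⊖ δ ∈ dirs
  neg-dir = All.lookup (toWitness {a? = All.all? (λ δ → ⊖ δ ∈? dirs) dirs} _)

  Link-sym : ∀ {c d} → Link c d → Link d c
  Link-sym {c} {d} (sc , sd , (δ , δ∈ , eq) , unsep) =
    sd , sc , (⊖ δ , neg-dir δ∈ , ⊕-⊖ δ eq) ,
    λ (e , se , h , h') → unsep (e , se , GAdj-sym {e} {c} h' , GAdj-sym {d} {e} h)

  dir-≢ : ∀ {c δ} → δ ∈ dirs → c ≢ c ⊕ δ
  dir-≢ {c} {δ} δ∈ eq = All.lookup nonzero δ∈ (⊕-cancelˡ c (trans (⊕-identityʳ c) eq))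
    where
    nonzero : All (𝟎 ≢_) dirs
    nonzero = toWitness {a? = All.all? (λ δ → ¬? (𝟎 ≟ δ)) dirs} _

  Link⇒≢ : ∀ {c d} → Link c d → c ≢ d
  Link⇒≢ (_ , _ , (δ , δ∈ , eq) , _) c≡d = dir-≢ δ∈ (trans c≡d eq)

  -- If `e` separates `c` from `d`, it shares an edge with both. Links across an edge are never
  -- separated, since that would need a triangle in a bipartite graph, and `blocker-check` puts `p`
  -- on `e`. So squares at a common vertex are joined by links between squares at that vertex.
  touching⇒Link : ∀ {c d p} → Square c → Square d → Corner c p → Corner d p →
    c ≡ d ⊎ Link c d ⊎ ∃[ e ] (Corner e p × Link c e × Link e d)
  touching⇒Link {c} {d} {p} sc sd hp hq with touching {c} {d} hp hq
  ... | inj₁ eq = inj₁ (sym eq)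
  ... | inj₂ (δ , δ∈ , refl) with Separated? c d
  ...   | no unsep = inj₂ (inj₁ (sc , sd , (δ , δ∈ , refl) , unsep))
  ...   | yes (e , se , ce , ed) =
    inj₂ (inj₂ (e , p∈e (GAdj⇒unit {c} {e} ce) (Corner⇒offset {c} hp) (Corner⇒offset {d} hq) ,
      adjacent se sc ce , Link-sym (adjacent se sd (GAdj-sym {e} {d} ed))))
    where
    adjacent : ∀ {c e} → Square e → Square c → GAdj c e → Link c e
    adjacent {c} {e} se sc ce with GAdj⇒unit {c} {e} ce
    ... | ε , ε∈ , eq = sc , se , (ε , unit⇒dir ε∈ , eq) ,
      λ (f , _ , cf , fe) → no-triangle {c} {f} {e} cf fe ce
    p∈e : (∃[ ε ] (ε ∈ units × e ≡ c ⊕ ε)) → (∃[ γ ] (γ ∈ corners × p ≡ c ⊕ γ)) →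
      (∃[ γ' ] (γ' ∈ corners × p ≡ d ⊕ γ')) → Corner e p
    p∈e (ε , ε∈ , refl) (γ , γ∈ , refl) (γ' , γ'∈ , eq)
      with find (All.lookup (All.lookup (All.lookup (All.lookup blocker-check ε∈) δ∈) γ∈) γ'∈
             (GAdj-unshift c ed) (⊕-cancelˡ c (trans eq (⊕-assoc c δ γ'))))
    ... | β , β∈ , refl = subst (Corner e) (⊕-assoc c ε β) (offset⇒Corner e β∈)

  -- By `triangle-check`, one of the three squares would separate the other two.
  no-link-triangle : ∀ {c d e} → Link c d → Link d e → ¬ Link c e
  no-link-triangle {c} {d} {e} (sc , sd , (δ , δ∈ , refl) , u) (_ , se , (δ' , δ'∈ , refl) , u')
    (_ , _ , (δ'' , δ''∈ , eq) , u'')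
    with All.lookup (All.lookup triangle-check δ∈) δ''∈ (subst (_∈ dirs) δ'≡ δ'∈)
    where
    δ'≡ : δ' ≡ δ'' ⊕ ⊖ δ
    δ'≡ = trans (sym (⊖-⊕ δ δ')) (trans (⊕-comm (⊖ δ) (δ ⊕ δ'))
      (cong (_⊕ ⊖ δ) (⊕-cancelˡ c (trans (sym (⊕-assoc c δ δ')) eq))))
  ... | inj₁ (h , k) = u'' (d , sd , GAdj-from c h , subst (GAdj d) (sym eq) (GAdj-shift c k))
  ... | inj₂ (inj₁ (h , k)) = u
    (e , se , subst (GAdj c) (sym eq) (GAdj-from c h) , subst (λ z → GAdj z d) (sym eq) (GAdj-shift c k))
  ... | inj₂ (inj₂ (h , k)) = u'
    (c , sc , subst (GAdj d) (⊕-identityʳ c) (GAdj-shift c h) , subst (GAdj c) (sym eq) (GAdj-from c k))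

  module Avoiding (avoid : FAvoiding S) where

    -- Otherwise `three-links-check` yields either a square contradicting the unseparatedness of a
    -- link or an induced X.
    two-links : ∀ {c d₁ d₂ d₃} → Link c d₁ → Link c d₂ → Link c d₃ →
      d₁ ≡ d₂ ⊎ d₁ ≡ d₃ ⊎ d₂ ≡ d₃
    two-links {c} (sc , s₁ , (δ₁ , δ₁∈ , refl) , u₁) (_ , s₂ , (δ₂ , δ₂∈ , refl) , u₂) (_ , s₃ , (δ₃ , δ₃∈ , refl) , u₃)
      with All.lookup (All.lookup (All.lookup three-links-check δ₁∈) δ₂∈) δ₃∈
    ... | inj₁ eq = inj₁ (cong (c ⊕_) eq)
    ... | inj₂ (inj₁ eq) = inj₂ (inj₁ (cong (c ⊕_) eq))
    ... | inj₂ (inj₂ (inj₁ eq)) = inj₂ (inj₂ (cong (c ⊕_) eq))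
    ... | inj₂ (inj₂ (inj₂ bad)) = ⊥-elim (refute bad)
      where
      δs = 𝟎 ∷ δ₁ ∷ δ₂ ∷ δ₃ ∷ []
      all-squares : ∀ {δ} → δ ∈ δs → Square (c ⊕ δ)
      all-squares (here refl) = subst Square (sym (⊕-identityʳ c)) sc
      all-squares (there (here refl)) = s₁
      all-squares (there (there (here refl))) = s₂
      all-squares (there (there (there (here refl)))) = s₃
      unseparated : ∀ {δ} → δ ∈ δ₁ ∷ δ₂ ∷ δ₃ ∷ [] → ¬ (∃[ e ] (Square e × GAdj c e × GAdj e (c ⊕ δ)))
      unseparated (here refl) = u₁
      unseparated (there (here refl)) = u₂
      unseparated (there (there (here refl))) = u₃
      P = cover δs
      refute : Blocked P (δ₁ ∷ δ₂ ∷ δ₃ ∷ []) ⊎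
        Any.Any (λ τ → points (λ i → τ (X-points i)) ⊆ P) symmetries → ⊥
      refute (inj₁ blocked) with find blocked
      ... | δ , δ∈ , b with find {P = λ ε → GAdj ε δ × cover (ε ∷ []) ⊆ P} b
      ...   | ε , ε∈ , adj , sub = unseparated δ∈ (c ⊕ ε ,
                ∈-square (λ {γ} γ∈ → subst (_∈ S) (sym (⊕-assoc c ε γ))
                  (covered-∈ c all-squares (All.lookup sub (∈-++⁺ˡ (∈-map⁺ (ε ⊕_) γ∈))))) ,
                GAdj-unit c ε∈ , GAdj-shift c adj)
      refute (inj₂ embedded) with find embedded
      ... | τ , τ∈ , sub = proj₁ avoid ((λ i → c ⊕ τ (X-points i)) ,
              (λ i → covered-∈ c all-squares (All.lookup sub (points-∈ (λ i → τ (X-points i)) i))) ,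
              Induced-shift XGraph (λ i → τ (X-points i)) c (All.lookup X-induced τ∈))

    -- Four distinct squares at `p` would contain the ring of eight vertices around `p`, an induced
    -- C₈.
    three-squares : ∀ {p c₁ c₂ c₃ c₄} → Square c₁ → Square c₂ → Square c₃ → Square c₄ →
      Corner c₁ p → Corner c₂ p → Corner c₃ p → Corner c₄ p →
      Any.Any (λ (c , d) → c ≡ d)
        ((c₁ , c₂) ∷ (c₁ , c₃) ∷ (c₁ , c₄) ∷ (c₂ , c₃) ∷ (c₂ , c₄) ∷ (c₃ , c₄) ∷ [])
    three-squares {p} {c₁} {c₂} {c₃} {c₄} s₁ s₂ s₃ s₄ h₁ h₂ h₃ h₄
      with Corner⇒offset {c₁} h₁ | Corner⇒offset {c₂} h₂ | Corner⇒offset {c₃} h₃ | Corner⇒offset {c₄} h₄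
    ... | γ₁ , γ₁∈ , e₁ | γ₂ , γ₂∈ , e₂ | γ₃ , γ₃∈ , e₃ | γ₄ , γ₄∈ , e₄
      with ⊕-⊖ {p} {c₁} γ₁ e₁ | ⊕-⊖ {p} {c₂} γ₂ e₂ | ⊕-⊖ {p} {c₃} γ₃ e₃ | ⊕-⊖ {p} {c₄} γ₄ e₄
    ... | refl | refl | refl | refl
      with All.lookup (All.lookup (All.lookup (All.lookup four-squares-check γ₁∈) γ₂∈) γ₃∈) γ₄∈
    ... | inj₁ h = Anyₚ.map⁺ {f = λ (γ , γ') → p ⊕ ⊖ γ , p ⊕ ⊖ γ'} (Any.map (cong (λ γ → p ⊕ ⊖ γ)) h)
    ... | inj₂ sub = ⊥-elim (proj₂ avoid 4 (ℕ.s≤s (ℕ.s≤s (ℕ.s≤s (ℕ.s≤s ℕ.z≤n))))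
            ((λ i → p ⊕ ring i) ,
             (λ i → covered-∈ p all-squares (All.lookup sub (points-∈ ring i))) ,
             Induced-shift (Cycle 8) ring p ring-induced))
      where
      all-squares : ∀ {δ} → δ ∈ ⊖ γ₁ ∷ ⊖ γ₂ ∷ ⊖ γ₃ ∷ ⊖ γ₄ ∷ [] → Square (p ⊕ δ)
      all-squares (here refl) = s₁
      all-squares (there (here refl)) = s₂
      all-squares (there (there (here refl))) = s₃
      all-squares (there (there (there (here refl)))) = s₄

-- Closed walks of length four and six.

four-cycle : ∀ {p q r s} → GAdj p q → GAdj q r → GAdj r s → GAdj s p →
  p ≡ r ⊎ q ≡ s ⊎ ∃[ c ] ((∀ {γ} → γ ∈ corners → c ⊕ γ ∈ p ∷ q ∷ r ∷ s ∷ []) ×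
    All (Corner c) (p ∷ q ∷ r ∷ s ∷ []))
four-cycle {p} {q} {r} {s} pq qr rs sp with GAdj⇒unit {p} {q} pq | GAdj⇒unit {q} {r} qr | GAdj⇒unit {r} {s} rs
... | δ₁ , δ₁∈ , refl | δ₂ , δ₂∈ , refl | δ₃ , δ₃∈ , refl =
  conclude (All.lookup (All.lookup (All.lookup four-cycle-check δ₁∈) δ₂∈) δ₃∈
    (GAdj-unshift p (subst₂ GAdj s≡ p≡ sp)))
  where
  p≡ : p ≡ p ⊕ 𝟎
  p≡ = sym (⊕-identityʳ p)
  r≡ : p ⊕ δ₁ ⊕ δ₂ ≡ p ⊕ (δ₁ ⊕ δ₂)
  r≡ = ⊕-assoc p δ₁ δ₂
  s≡ : p ⊕ δ₁ ⊕ δ₂ ⊕ δ₃ ≡ p ⊕ (δ₁ ⊕ δ₂ ⊕ δ₃)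
  s≡ = trans (cong (_⊕ δ₃) r≡) (⊕-assoc p (δ₁ ⊕ δ₂) δ₃)
  offsets : List Point
  offsets = 𝟎 ∷ δ₁ ∷ δ₁ ⊕ δ₂ ∷ δ₁ ⊕ δ₂ ⊕ δ₃ ∷ []
  conclude : (δ₁ ⊕ δ₂ ≡ 𝟎) ⊎ (δ₁ ⊕ δ₂ ⊕ δ₃ ≡ δ₁) ⊎
    Any.Any (λ γ → All (λ β → Any.Any (λ ε → ⊖ γ ⊕ β ≡ ε) offsets) corners ×
                    All (λ ε → γ ⊕ ε ∈ corners) offsets) corners → _
  conclude (inj₁ eq) = inj₁ (trans p≡ (trans (cong (p ⊕_) (sym eq)) (sym r≡)))
  conclude (inj₂ (inj₁ eq)) = inj₂ (inj₁ (trans (cong (p ⊕_) (sym eq)) (sym s≡)))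
  conclude (inj₂ (inj₂ found)) with find {P = λ γ → All (λ β → Any.Any (λ ε → ⊖ γ ⊕ β ≡ ε) offsets) corners ×
                    All (λ ε → γ ⊕ ε ∈ corners) offsets} found
  ... | γ , _ , occupied , inside = inj₂ (inj₂ (c ,
      (λ {β} β∈ → vertex β (All.lookup occupied β∈)) ,
      corner p≡ (All.lookup inside (here refl)) ∷
      corner refl (All.lookup inside (there (here refl))) ∷
      corner r≡ (All.lookup inside (there (there (here refl)))) ∷
      corner s≡ (All.lookup inside (there (there (there (here refl))))) ∷ []))
    where
    c : Point
    c = p ⊕ ⊖ γ
    vertex : ∀ β → Any.Any (λ ε → ⊖ γ ⊕ β ≡ ε) offsets →
      c ⊕ β ∈ p ∷ p ⊕ δ₁ ∷ p ⊕ δ₁ ⊕ δ₂ ∷ p ⊕ δ₁ ⊕ δ₂ ⊕ δ₃ ∷ []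
    vertex β h = subst (_∈ _) (sym (⊕-assoc p (⊖ γ) β)) (go h)
      where
      go : Any.Any (λ ε → ⊖ γ ⊕ β ≡ ε) offsets → p ⊕ (⊖ γ ⊕ β) ∈ _
      go (here eq) = here (trans (cong (p ⊕_) eq) (sym p≡))
      go (there (here eq)) = there (here (cong (p ⊕_) eq))
      go (there (there (here eq))) = there (there (here (trans (cong (p ⊕_) eq) (sym r≡))))
      go (there (there (there (here eq)))) = there (there (there (here (trans (cong (p ⊕_) eq) (sym s≡)))))
    corner : ∀ {v ε} → v ≡ p ⊕ ε → γ ⊕ ε ∈ corners → Corner c v
    corner {v} {ε} eq m = subst (Corner c)
      (trans (⊕-assoc p (⊖ γ) (γ ⊕ ε)) (trans (cong (p ⊕_) (⊖-⊕ γ ε)) (sym eq)))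
      (offset⇒Corner c m)

hexagon-chord : ∀ {p q r s t u} → GAdj p q → GAdj q r → GAdj r s → GAdj s t → GAdj t u → GAdj u p →
  p ≡ r ⊎ q ≡ s ⊎ r ≡ t ⊎ s ≡ u ⊎ GAdj p s ⊎ GAdj q t ⊎ GAdj r u
hexagon-chord {p} {q} {r} {s} {t} {u} pq qr rs st tu up
  with GAdj⇒unit {p} {q} pq | GAdj⇒unit {q} {r} qr | GAdj⇒unit {r} {s} rs | GAdj⇒unit {s} {t} st | GAdj⇒unit {t} {u} tu
... | δ₁ , δ₁∈ , refl | δ₂ , δ₂∈ , refl | δ₃ , δ₃∈ , refl | δ₄ , δ₄∈ , refl | δ₅ , δ₅∈ , refl =
  conclude (All.lookup (All.lookup (All.lookup (All.lookup (All.lookup hexagon-check δ₁∈) δ₂∈) δ₃∈) δ₄∈) δ₅∈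
    (GAdj-unshift p (subst₂ GAdj u≡ p≡ up)))
  where
  p≡ : p ≡ p ⊕ 𝟎
  p≡ = sym (⊕-identityʳ p)
  r≡ : p ⊕ δ₁ ⊕ δ₂ ≡ p ⊕ (δ₁ ⊕ δ₂)
  r≡ = ⊕-assoc p δ₁ δ₂
  s≡ : p ⊕ δ₁ ⊕ δ₂ ⊕ δ₃ ≡ p ⊕ (δ₁ ⊕ δ₂ ⊕ δ₃)
  s≡ = trans (cong (_⊕ δ₃) r≡) (⊕-assoc p _ δ₃)
  t≡ : p ⊕ δ₁ ⊕ δ₂ ⊕ δ₃ ⊕ δ₄ ≡ p ⊕ (δ₁ ⊕ δ₂ ⊕ δ₃ ⊕ δ₄)
  t≡ = trans (cong (_⊕ δ₄) s≡) (⊕-assoc p _ δ₄)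
  u≡ : p ⊕ δ₁ ⊕ δ₂ ⊕ δ₃ ⊕ δ₄ ⊕ δ₅ ≡ p ⊕ (δ₁ ⊕ δ₂ ⊕ δ₃ ⊕ δ₄ ⊕ δ₅)
  u≡ = trans (cong (_⊕ δ₅) t≡) (⊕-assoc p _ δ₅)
  same : ∀ {v w ε η} → v ≡ p ⊕ ε → w ≡ p ⊕ η → η ≡ ε → v ≡ w
  same refl refl refl = refl
  joined : ∀ {v w ε η} → v ≡ p ⊕ ε → w ≡ p ⊕ η → GAdj ε η → GAdj v w
  joined refl refl h = GAdj-shift p h
  conclude : δ₁ ⊕ δ₂ ≡ 𝟎 ⊎ δ₁ ⊕ δ₂ ⊕ δ₃ ≡ δ₁ ⊎ δ₁ ⊕ δ₂ ⊕ δ₃ ⊕ δ₄ ≡ δ₁ ⊕ δ₂ ⊎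
    δ₁ ⊕ δ₂ ⊕ δ₃ ⊕ δ₄ ⊕ δ₅ ≡ δ₁ ⊕ δ₂ ⊕ δ₃ ⊎
    GAdj 𝟎 (δ₁ ⊕ δ₂ ⊕ δ₃) ⊎ GAdj δ₁ (δ₁ ⊕ δ₂ ⊕ δ₃ ⊕ δ₄) ⊎ GAdj (δ₁ ⊕ δ₂) (δ₁ ⊕ δ₂ ⊕ δ₃ ⊕ δ₄ ⊕ δ₅) → _
  conclude (inj₁ eq) = inj₁ (same p≡ r≡ eq)
  conclude (inj₂ (inj₁ eq)) = inj₂ (inj₁ (same refl s≡ eq))
  conclude (inj₂ (inj₂ (inj₁ eq))) = inj₂ (inj₂ (inj₁ (same r≡ t≡ eq)))
  conclude (inj₂ (inj₂ (inj₂ (inj₁ eq)))) = inj₂ (inj₂ (inj₂ (inj₁ (same s≡ u≡ eq))))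
  conclude (inj₂ (inj₂ (inj₂ (inj₂ (inj₁ h))))) = inj₂ (inj₂ (inj₂ (inj₂ (inj₁ (joined p≡ s≡ h)))))
  conclude (inj₂ (inj₂ (inj₂ (inj₂ (inj₂ (inj₁ h)))))) = inj₂ (inj₂ (inj₂ (inj₂ (inj₂ (inj₁ (joined refl t≡ h))))))
  conclude (inj₂ (inj₂ (inj₂ (inj₂ (inj₂ (inj₂ h)))))) = inj₂ (inj₂ (inj₂ (inj₂ (inj₂ (inj₂ (joined r≡ u≡ h))))))

-- Walks and mod 2 totals of closed walks.

even⇒double : ∀ n → parityℕ n ≡ false → ∃[ m ] n ≡ 2 ℕ.* m
even⇒double zero _ = 0 , refl
even⇒double (suc (suc n)) h with even⇒double n (trans (sym (not-involutive _)) h)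
... | m , refl = suc m , cong suc (sym (ℕₚ.+-suc m (m ℕ.+ 0)))

xor-falseʳ : ∀ a b → a xor b ≡ b → a ≡ false
xor-falseʳ false _ _ = refl
xor-falseʳ true false ()
xor-falseʳ true true ()

module Walks (S : List Point) where

  len : ∀ {p q} → Walk S p q → ℕ
  len here = 0
  len (there _ _ w) = suc (len w)

  infixr 5 _++ʷ_
  _++ʷ_ : ∀ {p q r} → Walk S p q → Walk S q r → Walk S p r
  here ++ʷ v = v
  there h m w ++ʷ v = there h m (w ++ʷ v)

  len-++ : ∀ {p q r} (w : Walk S p q) (v : Walk S q r) → len (w ++ʷ v) ≡ len w ℕ.+ len v
  len-++ here v = refl
  len-++ (there _ _ w) v = cong suc (len-++ w v)

  -- Indices past the length return the endpoint.
  at : ∀ {p q} → Walk S p q → ℕ → Point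
  at {p} here _ = p
  at {p} (there _ _ _) zero = p
  at (there _ _ w) (suc i) = at w i

  takeʷ : ∀ {p q} (w : Walk S p q) i → Walk S p (at w i)
  takeʷ here _ = here
  takeʷ (there _ _ _) zero = here
  takeʷ (there h m w) (suc i) = there h m (takeʷ w i)

  dropʷ : ∀ {p q} (w : Walk S p q) i → Walk S (at w i) q
  dropʷ here _ = here
  dropʷ w@(there _ _ _) zero = w
  dropʷ (there _ _ w) (suc i) = dropʷ w i

  take-drop : ∀ {p q} (w : Walk S p q) i → takeʷ w i ++ʷ dropʷ w i ≡ w
  take-drop here _ = refl
  take-drop (there _ _ _) zero = refl
  take-drop (there h m w) (suc i) = cong (there h m) (take-drop w i)

  len-take : ∀ {p q} (w : Walk S p q) {i} → i ≤ len w → len (takeʷ w i) ≡ i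
  len-take here z≤n = refl
  len-take (there _ _ w) z≤n = refl
  len-take (there _ _ w) (s≤s h) = cong suc (len-take w h)

  at-drop : ∀ {p q} (w : Walk S p q) i k → at (dropʷ w i) k ≡ at w (i ℕ.+ k)
  at-drop here _ _ = refl
  at-drop (there _ _ _) zero _ = refl
  at-drop (there _ _ w) (suc i) k = at-drop w i k

  at-start : ∀ {p q} (w : Walk S p q) → at w 0 ≡ p
  at-start here = refl
  at-start (there _ _ _) = refl

  at-end : ∀ {p q} (w : Walk S p q) → at w (len w) ≡ q
  at-end here = refl
  at-end (there _ _ w) = at-end w

  at-∈ : ∀ {p q} → p ∈ S → (w : Walk S p q) → ∀ i → at w i ∈ S
  at-∈ p∈ here _ = p∈
  at-∈ p∈ (there _ _ _) zero = p∈
  at-∈ _ (there _ m w) (suc i) = at-∈ m w i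

  at-step : ∀ {p q} (w : Walk S p q) {i} → i < len w → GAdj (at w i) (at w (suc i))
  at-step {p} (there {q = q} h _ w) {zero} _ = subst (GAdj p) (sym (at-start w)) h
  at-step (there _ _ w) {suc i} (s≤s l) = at-step w l

  parity-walk : ∀ {p q} (w : Walk S p q) → parity q ≡ parityℕ (len w) xor parity p
  parity-walk here = refl
  parity-walk {p} (there {q = q} h _ w) = trans (parity-walk w)
    (trans (cong (parityℕ (len w) xor_) (parity-adj {p} {q} h)) (lem (parityℕ (len w)) (parity p)))
    where
    lem : ∀ a b → a xor not b ≡ not a xor b
    lem false b = refl
    lem true false = refl
    lem true true = refl

  module Cochain (φ : Point → Point → Bool) where

    total : ∀ {p q} → Walk S p q → Bool
    total here = false
    total {p} (there {q = q} _ _ w) = φ p q xor total w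

    total-++ : ∀ {p q r} (w : Walk S p q) (v : Walk S q r) → total (w ++ʷ v) ≡ total w xor total v
    total-++ here v = refl
    total-++ {p} (there {q = q} _ _ w) v =
      trans (cong (φ p q xor_) (total-++ w v)) (sym (xor-assoc (φ p q) (total w) (total v)))

-- `exact` gives a potential for each square separately. Potentials of neighbouring squares need not
-- agree, so vanishing on all closed walks is a genuine global statement.
module Loops (S : List Point) (avoid : FAvoiding S) (cos : ConsistsOfSquares S) (φ : Point → Point → Bool)
  (exact : ∀ {c} → IsSquare S c →
    Σ (Point → Bool) λ χ → ∀ u v → Corner c u → Corner c v → GAdj u v → φ u v ≡ χ u xor χ v)
  where

  open Squares S
  open Walks S
  open Cochain φ

  φ-sym : ∀ {u v} → u ∈ S → v ∈ S → GAdj u v → φ u v ≡ φ v u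
  φ-sym {u} {v} u∈ v∈ h with proj₂ cos u v u∈ v∈ h
  ... | c , sq , hu , hv with exact {c} sq
  ...   | χ , eq = trans (eq u v hu hv h) (trans (xor-comm (χ u) (χ v)) (sym (eq v u hv hu (GAdj-sym {u} {v} h))))

  -- For an adjacency, `2 ≤ d` makes the loop that takes the chord instead of the segment shorter
  -- than `w`, and `2 + d ≤ len w` does the same for the segment closed by the chord. Together they
  -- exclude consecutive vertices and the closing edge.
  ChordAt : ∀ {p q} → Walk S p q → ℕ → ℕ → Set
  ChordAt w i d = 0 < d × i ℕ.+ d < len w ×
    (at w i ≡ at w (i ℕ.+ d) ⊎ GAdj (at w i) (at w (i ℕ.+ d)) × 2 ≤ d × 2 ℕ.+ d ≤ len w)

  Chord : ∀ {p q} → Walk S p q → Set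
  Chord w = ∃[ i ] (i < len w × ∃[ d ] (d < len w × ChordAt w i d))

  Chord? : ∀ {p q} (w : Walk S p q) → Dec (Chord w)
  Chord? w = ℕₚ.anyUpTo? (λ i → ℕₚ.anyUpTo? (λ d →
    (0 ℕ.<? d) ×-dec (i ℕ.+ d ℕ.<? len w) ×-dec
    ((at w i ≟ at w (i ℕ.+ d)) ⊎-dec
     (GAdj? (at w i) (at w (i ℕ.+ d)) ×-dec (2 ℕ.≤? d) ×-dec (2 ℕ.+ d ℕ.≤? len w)))) (len w)) (len w)

  chord-at : ∀ {p q} (w : Walk S p q) i d → ChordAt w i d → Chord w
  chord-at w i d h@(_ , l , _) =
    i , ℕₚ.≤-<-trans (ℕₚ.m≤m+n i d) l , d , ℕₚ.≤-<-trans (ℕₚ.m≤n+m d i) l , h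

  module Chordless {p} (p∈ : p ∈ S) (w : Walk S p p) (chordless : ¬ Chord w) where

    distinct : ∀ {i j} → i < j → j < len w → at w i ≢ at w j
    distinct {i} {j} i<j j<n eq = chordless (chord-at w i (j ∸ i)
      (ℕₚ.m<n⇒0<n∸m i<j , subst (_< len w) (sym j≡) j<n , inj₁ (trans eq (cong (at w) (sym j≡)))))
      where
      j≡ : i ℕ.+ (j ∸ i) ≡ j
      j≡ = ℕₚ.m+[n∸m]≡n (ℕₚ.<⇒≤ i<j)

    neighbours : ∀ {i j} → i < j → j < len w → GAdj (at w i) (at w j) → suc i ≡ j ⊎ (i ≡ 0 × suc j ≡ len w)
    neighbours {i} {j} i<j j<n adj with suc i ℕ.≟ j | (i ℕ.≟ 0) ×-dec (suc j ℕ.≟ len w)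
    ... | yes eq | _ = inj₁ eq
    ... | no _ | yes eqs = inj₂ eqs
    ... | no i+1≢j | no not-closing = contradiction (chord-at w i d
      (ℕₚ.m<n⇒0<n∸m i<j , subst (_< len w) (sym j≡) j<n ,
       inj₂ (subst (λ k → GAdj (at w i) (at w k)) (sym j≡) adj , 2≤d , 2+d≤n i refl))) chordless
      where
      d = j ∸ i
      j≡ : i ℕ.+ d ≡ j
      j≡ = ℕₚ.m+[n∸m]≡n (ℕₚ.<⇒≤ i<j)
      2≤d : 2 ≤ d
      2≤d = subst (_≤ d) (ℕₚ.m+n∸n≡m 2 i) (ℕₚ.∸-monoˡ-≤ i (ℕₚ.≤∧≢⇒< i<j i+1≢j))
      2+d≤n : ∀ k → k ≡ i → 2 ℕ.+ d ≤ len w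
      2+d≤n zero refl = ℕₚ.≤∧≢⇒< j<n (λ eq → not-closing (refl , eq))
      2+d≤n (suc k) refl = ℕₚ.≤-trans (s≤s (subst (suc d ≤_) j≡ (s≤s (ℕₚ.m≤n+m d k)))) j<n

    embedded : ∀ {m} → len w ≡ 2 ℕ.* m → ContainsInduced S (Cycle (2 ℕ.* m))
    embedded {m} n≡ = f , (λ i → at-∈ p∈ w (toℕ i)) , inj , λ i j i≢j → mk⇔ to (from i≢j)
      where
      f : Fin (2 ℕ.* m) → Point
      f i = at w (toℕ i)
      bound : ∀ (i : Fin (2 ℕ.* m)) → toℕ i < len w
      bound i = subst (toℕ i <_) (sym n≡) (Finₚ.toℕ<n i)
      inj : ∀ i j → f i ≡ f j → i ≡ j
      inj i j eq with ℕₚ.<-cmp (toℕ i) (toℕ j)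
      ... | tri< l _ _ = contradiction eq (distinct l (bound j))
      ... | tri≈ _ e _ = Finₚ.toℕ-injective e
      ... | tri> _ _ l = contradiction (sym eq) (distinct l (bound i))
      next : ∀ {i j} → CNext (2 ℕ.* m) i j → GAdj (f i) (f j)
      next {i} {j} (inj₁ e) = subst (λ k → GAdj (f i) (at w k)) e (at-step w (bound i))
      next {i} {j} (inj₂ (e , z)) = subst (GAdj (f i)) closing (at-step w (bound i))
        where
        closing : at w (suc (toℕ i)) ≡ f j
        closing = trans (cong (at w) (trans e (sym n≡)))
          (trans (at-end w) (trans (sym (at-start w)) (cong (at w) (sym z))))
      to : ∀ {i j} → CNext (2 ℕ.* m) i j ⊎ CNext (2 ℕ.* m) j i → GAdj (f i) (f j)
      to {i} {j} (inj₁ h) = next {i} {j} h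
      to {i} {j} (inj₂ h) = GAdj-sym {f j} {f i} (next {j} {i} h)
      ordered : ∀ {i j} → toℕ i < toℕ j → GAdj (f i) (f j) → CNext (2 ℕ.* m) i j ⊎ CNext (2 ℕ.* m) j i
      ordered {i} {j} l h with neighbours l (bound j) h
      ... | inj₁ e = inj₁ (inj₁ e)
      ... | inj₂ (z , e) = inj₂ (inj₂ (trans e n≡ , z))
      from : ∀ {i j} → i ≢ j → GAdj (f i) (f j) → CNext (2 ℕ.* m) i j ⊎ CNext (2 ℕ.* m) j i
      from {i} {j} i≢j h with ℕₚ.<-cmp (toℕ i) (toℕ j)
      ... | tri< l _ _ = ordered l h
      ... | tri≈ _ e _ = contradiction (Finₚ.toℕ-injective e) i≢j
      ... | tri> _ _ l with ordered l (GAdj-sym {f i} {f j} h)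
      ...   | inj₁ e = inj₂ e
      ...   | inj₂ e = inj₁ e

  total-digon : ∀ {p} → p ∈ S → (w : Walk S p p) → len w ≡ 2 → total w ≡ false
  total-digon {p} p∈ (there {q = q} h m (there _ _ here)) refl =
    trans (cong₂ _xor_ (φ-sym p∈ m h) (xor-identityʳ (φ q p))) (xor-same (φ q p))

  total-square : ∀ {p} → p ∈ S → (w : Walk S p p) → len w ≡ 4 → ¬ Chord w → total w ≡ false
  total-square {p} p∈ w@(there {q = q} pq q∈ (there {q = r} qr r∈ (there {q = s} rs s∈ (there sp _ here)))) refl chordless
    with four-cycle {p} {q} {r} {s} pq qr rs sp
  ... | inj₁ eq = contradiction (chord-at w 0 2 (s≤s z≤n , s≤s (s≤s (s≤s z≤n)) , inj₁ eq)) chordless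
  ... | inj₂ (inj₁ eq) = contradiction (chord-at w 1 2 (s≤s z≤n , s≤s (s≤s (s≤s (s≤s z≤n))) , inj₁ eq)) chordless
  ... | inj₂ (inj₂ (c , occupied , cp ∷ cq ∷ cr ∷ cs ∷ []))
      with exact {c} (∈-square {c} (λ γ∈ → All.lookup (p∈ ∷ q∈ ∷ r∈ ∷ s∈ ∷ []) (occupied γ∈)))
  ...   | χ , eq rewrite eq p q cp cq pq | eq q r cq cr qr | eq r s cr cs rs | eq s p cs cp sp = lem (χ p) (χ q) (χ r) (χ s)
    where
    lem : ∀ a b c d → (a xor b) xor ((b xor c) xor ((c xor d) xor ((d xor a) xor false))) ≡ false
    lem = solve 4 (λ a b c d → (a :+ b) :+ ((b :+ c) :+ ((c :+ d) :+ ((d :+ a) :+ con false))) := con false) refl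
      where open xor-∧-Solver

  hexagon : ∀ {p} (w : Walk S p p) → len w ≡ 6 → Chord w
  hexagon {p} w@(there {q = q} pq _ (there {q = r} qr _ (there {q = s} rs _
    (there {q = t} st _ (there {q = u} tu _ (there up _ here)))))) refl
    with hexagon-chord {p} {q} {r} {s} {t} {u} pq qr rs st tu up
  ... | inj₁ e = chord-at w 0 2 (s≤s z≤n , ℕₚ.<ᵇ⇒< 2 6 _ , inj₁ e)
  ... | inj₂ (inj₁ e) = chord-at w 1 2 (s≤s z≤n , ℕₚ.<ᵇ⇒< 3 6 _ , inj₁ e)
  ... | inj₂ (inj₂ (inj₁ e)) = chord-at w 2 2 (s≤s z≤n , ℕₚ.<ᵇ⇒< 4 6 _ , inj₁ e)
  ... | inj₂ (inj₂ (inj₂ (inj₁ e))) = chord-at w 3 2 (s≤s z≤n , ℕₚ.<ᵇ⇒< 5 6 _ , inj₁ e)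
  ... | inj₂ (inj₂ (inj₂ (inj₂ (inj₁ h)))) = chord-at w 0 3 (s≤s z≤n , ℕₚ.<ᵇ⇒< 3 6 _ ,
    inj₂ (h , ℕₚ.<ᵇ⇒< 1 3 _ , ℕₚ.<ᵇ⇒< 4 6 _))
  ... | inj₂ (inj₂ (inj₂ (inj₂ (inj₂ (inj₁ h))))) = chord-at w 1 3 (s≤s z≤n , ℕₚ.<ᵇ⇒< 4 6 _ ,
    inj₂ (h , ℕₚ.<ᵇ⇒< 1 3 _ , ℕₚ.<ᵇ⇒< 4 6 _))
  ... | inj₂ (inj₂ (inj₂ (inj₂ (inj₂ (inj₂ h))))) = chord-at w 2 3 (s≤s z≤n , ℕₚ.<ᵇ⇒< 5 6 _ ,
    inj₂ (h , ℕₚ.<ᵇ⇒< 1 3 _ , ℕₚ.<ᵇ⇒< 4 6 _))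

  -- The cases are the values of half the length, which exists because parity makes a closed walk
  -- even; from 4 on the walk is a forbidden induced cycle.
  chordless-total : ∀ {p} → p ∈ S → (w : Walk S p p) → ¬ Chord w → total w ≡ false
  chordless-total {p} p∈ w chordless with even⇒double (len w) (xor-falseʳ (parityℕ (len w)) (parity p) (sym (parity-walk w)))
  ... | zero , n≡ = empty w n≡
    where
    empty : ∀ {q} (w : Walk S p q) → len w ≡ 0 → total w ≡ false
    empty here _ = refl
  ... | suc zero , n≡ = total-digon p∈ w n≡
  ... | suc (suc zero) , n≡ = total-square p∈ w n≡ chordless
  ... | suc (suc (suc zero)) , n≡ = contradiction (hexagon w n≡) chordless
  ... | suc (suc (suc (suc m))) , n≡ = ⊥-elim (proj₂ avoid (4 ℕ.+ m) (ℕₚ.m≤m+n 4 m)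
    (Chordless.embedded p∈ w chordless {4 ℕ.+ m} n≡))

  -- A chord (or a repeated vertex) splits a closed walk into two shorter ones
  -- whose totals add up, so a shortest closed walk of nonzero total is an induced cycle.
  total-loop : ∀ n {p} → p ∈ S → (w : Walk S p p) → len w ≡ n → total w ≡ false
  total-loop = <-rec _ step
    where
    step : ∀ n → (∀ {k} → k < n → ∀ {p} → p ∈ S → (w : Walk S p p) → len w ≡ k → total w ≡ false) →
      ∀ {p} → p ∈ S → (w : Walk S p p) → len w ≡ n → total w ≡ false
    step n rec {p} p∈ w refl with Chord? w
    ... | no chordless = chordless-total p∈ w chordless
    ... | yes (i , _ , d , _ , 0<d , i+d<n , chord) = split (at-drop w i d) chord
      where
      u v : Point
      u = at w i
      v = at (dropʷ w i) d
      a : Walk S p u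
      a = takeʷ w i
      b : Walk S u v
      b = takeʷ (dropʷ w i) d
      c : Walk S v p
      c = dropʷ (dropʷ w i) d
      w≡ : a ++ʷ b ++ʷ c ≡ w
      w≡ = trans (cong (a ++ʷ_) (take-drop (dropʷ w i) d)) (take-drop w i)
      u∈ : u ∈ S
      u∈ = at-∈ p∈ w i
      v∈ : v ∈ S
      v∈ = at-∈ u∈ (dropʷ w i) d
      lens : len a ℕ.+ (len b ℕ.+ len c) ≡ len w
      lens = trans (sym (trans (len-++ a (b ++ʷ c)) (cong (len a ℕ.+_) (len-++ b c)))) (cong len w≡)
      totals : total a xor (total b xor total c) ≡ total w
      totals = trans (sym (trans (total-++ a (b ++ʷ c)) (cong (total a xor_) (total-++ b c)))) (cong total w≡)
      len-a : len a ≡ i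
      len-a = len-take w (ℕₚ.≤-trans (ℕₚ.m≤m+n i d) (ℕₚ.<⇒≤ i+d<n))
      len-b : len b ≡ d
      len-b = len-take (dropʷ w i) (ℕₚ.+-cancelˡ-≤ i d _ (subst (i ℕ.+ d ≤_) (sym n≡) (ℕₚ.<⇒≤ i+d<n)))
        where
        n≡ : i ℕ.+ len (dropʷ w i) ≡ len w
        n≡ = trans (cong (ℕ._+ len (dropʷ w i)) (sym len-a)) (trans (sym (len-++ a (dropʷ w i))) (cong len (take-drop w i)))
      outer-< : ∀ k → k < d → len a ℕ.+ (k ℕ.+ len c) < len w
      outer-< k k<d = subst (len a ℕ.+ (k ℕ.+ len c) <_) lens
        (ℕₚ.+-monoʳ-< (len a) (ℕₚ.+-monoˡ-< (len c) (subst (k <_) (sym len-b) k<d)))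
      split : v ≡ at w (i ℕ.+ d) →
        u ≡ at w (i ℕ.+ d) ⊎ GAdj u (at w (i ℕ.+ d)) × 2 ≤ d × 2 ℕ.+ d ≤ len w → total w ≡ false
      split v≡ (inj₁ eq) = repeated (trans eq (sym v≡)) b c len-b lens totals (outer-< 0 0<d)
        where
        -- `v` is generalised, together with the facts about `b` and `c`, so that the equation can
        -- be matched and `b` becomes a loop.
        repeated : ∀ {v} → u ≡ v → (b : Walk S u v) (c : Walk S v p) → len b ≡ d →
          len a ℕ.+ (len b ℕ.+ len c) ≡ len w → total a xor (total b xor total c) ≡ total w →
          len a ℕ.+ len c < len w → total w ≡ false
        repeated refl b c len-b lens totals shorter = begin
          total w                           ≡⟨ sym totals ⟩
          total a xor (total b xor total c) ≡⟨ cong (λ z → total a xor (z xor total c)) inner ⟩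
          total a xor total c               ≡⟨ sym (total-++ a c) ⟩
          total (a ++ʷ c)                   ≡⟨ rec (subst (_< len w) (sym (len-++ a c)) shorter) p∈ (a ++ʷ c) refl ⟩
          false                             ∎
          where
          open ≡-Reasoning
          inner : total b ≡ false
          inner = rec (ℕₚ.≤-<-trans (subst (_≤ i ℕ.+ d) (sym len-b) (ℕₚ.m≤n+m d i)) i+d<n) u∈ b refl
      split v≡ (inj₂ (adj′ , 2≤d , 2+d≤n)) = begin
        total w                           ≡⟨ sym totals ⟩
        total a xor (total b xor total c) ≡⟨ lem (total a) (total b) (total c) (φ u v) inner ⟩
        total a xor (φ u v xor total c)   ≡⟨ sym (total-++ a (there adj v∈ c)) ⟩
        total (a ++ʷ there adj v∈ c)      ≡⟨ rec outer-shorter p∈ _ refl ⟩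
        false                             ∎
        where
        open ≡-Reasoning
        adj : GAdj u v
        adj = subst (GAdj u) (sym v≡) adj′
        back : Walk S v u
        back = there (GAdj-sym {u} {v} adj) u∈ here
        outer-shorter : len (a ++ʷ there adj v∈ c) < len w
        outer-shorter = subst (_< len w) (sym (len-++ a (there adj v∈ c))) (outer-< 1 2≤d)
        inner-shorter : len (b ++ʷ back) < len w
        inner-shorter = subst (_< len w)
          (sym (trans (len-++ b back) (trans (cong (ℕ._+ 1) len-b) (ℕₚ.+-comm d 1)))) 2+d≤n
        inner : total b xor φ u v ≡ false
        inner = begin
          total b xor φ u v           ≡⟨ cong (total b xor_) (trans (φ-sym u∈ v∈ adj) (sym (xor-identityʳ (φ v u)))) ⟩
          total b xor (φ v u xor false) ≡⟨ sym (total-++ b back) ⟩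
          total (b ++ʷ back)          ≡⟨ rec inner-shorter u∈ (b ++ʷ back) refl ⟩
          false                       ∎
        lem : ∀ a b c x → b xor x ≡ false → a xor (b xor c) ≡ a xor (x xor c)
        lem a false c false _ = refl
        lem a true c true _ = refl

-- Chains of linked squares, and the exclusion of rings.

abstract
  shared-edge-check : All (λ γ → All (λ γ' → All (λ β → All (λ β' →
    GAdj γ γ' → γ ⊕ ⊖ β ≡ γ' ⊕ ⊖ β' → γ ⊕ ⊖ β ≡ 𝟎 ⊎ GAdj 𝟎 (γ ⊕ ⊖ β)) corners) corners) corners) corners
  shared-edge-check = toWitness {a? = All.all? (λ γ → All.all? (λ γ' → All.all? (λ β → All.all? (λ β' →
    GAdj? γ γ' →-dec ((γ ⊕ ⊖ β ≟ γ' ⊕ ⊖ β') →-dec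
    ((γ ⊕ ⊖ β ≟ 𝟎) ⊎-dec GAdj? 𝟎 (γ ⊕ ⊖ β)))) corners) corners) corners) corners} _

  shared-corner-check : All (λ δ → Any.Any (λ γ → δ ⊕ γ ∈ corners) corners) dirs
  shared-corner-check = toWitness {a? = All.all? (λ δ → Any.any? (λ γ → δ ⊕ γ ∈? corners) corners) dirs} _

shared-edge : ∀ {c d u v} → Corner c u → Corner c v → Corner d u → Corner d v → GAdj u v →
  c ≡ d ⊎ GAdj c d
shared-edge {c} {d} cu cv du dv uv
  with Corner⇒offset {c} cu | Corner⇒offset {c} cv | Corner⇒offset {d} du | Corner⇒offset {d} dv
... | γ , γ∈ , refl | γ' , γ'∈ , refl | β , β∈ , e | β' , β'∈ , e' =
  conclude (All.lookup (All.lookup (All.lookup (All.lookup shared-edge-check γ∈) γ'∈) β∈) β'∈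
    (GAdj-unshift c uv) (⊕-cancelˡ c (trans (sym d≡) d≡')))
  where
  d≡ : d ≡ c ⊕ (γ ⊕ ⊖ β)
  d≡ = trans (⊕-⊖ β e) (⊕-assoc c γ (⊖ β))
  d≡' : d ≡ c ⊕ (γ' ⊕ ⊖ β')
  d≡' = trans (⊕-⊖ β' e') (⊕-assoc c γ' (⊖ β'))
  conclude : γ ⊕ ⊖ β ≡ 𝟎 ⊎ GAdj 𝟎 (γ ⊕ ⊖ β) → c ≡ d ⊎ GAdj c d
  conclude (inj₁ z) = inj₁ (sym (trans d≡ (trans (cong (c ⊕_) z) (⊕-identityʳ c))))
  conclude (inj₂ h) = inj₂ (subst (GAdj c) (sym d≡) (GAdj-from c h))

module Chains (S : List Point) (avoid : FAvoiding S) where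

  open Squares S
  open Avoiding avoid
  open Walks S

  Link-corner : ∀ {c d} → Link c d → ∃[ p ] (Corner c p × Corner d p)
  Link-corner {c} (_ , _ , (δ , δ∈ , refl) , _) with find (All.lookup shared-corner-check δ∈)
  ... | γ , γ∈ , m = c ⊕ (δ ⊕ γ) , offset⇒Corner c m ,
    subst (Corner (c ⊕ δ)) (⊕-assoc c δ γ) (offset⇒Corner (c ⊕ δ) γ∈)

  edge⇒Link : ∀ {c d} → Square c → Square d → GAdj c d → Link c d
  edge⇒Link {c} {d} sc sd cd with GAdj⇒unit {c} {d} cd
  ... | ε , ε∈ , eq = sc , sd , (ε , unit⇒dir ε∈ , eq) , λ (f , _ , cf , fd) → no-triangle {c} {f} {d} cf fd cd

  -- A chain has `suc m` squares, at the indices 0 to `m`; values of `sq` beyond `m` are arbitrary.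
  record Chain (m : ℕ) : Set where
    field
      sq : ℕ → Point
      square : ∀ {i} → i ≤ m → Square (sq i)
      link : ∀ {i} → i < m → Link (sq i) (sq (suc i))
      injective : ∀ {i j} → i ≤ m → j ≤ m → sq i ≡ sq j → i ≡ j

    Member : Point → Set
    Member d = ∃[ i ] (i < suc m × sq i ≡ d)

    Member? : ∀ d → Dec (Member d)
    Member? d = ℕₚ.anyUpTo? (λ i → sq i ≟ d) (suc m)

    -- This allows the two ends to be linked to each other; that case is removed later by `no-ring`.
    Saturated : Point → Set
    Saturated c = ∀ d → Link c d → Member d

    interior : ∀ {i d} → suc i < m → Link (sq (suc i)) d → d ≡ sq i ⊎ d ≡ sq (suc (suc i))
    interior {i} {d} l h with two-links (Link-sym (link (ℕₚ.<⇒≤ l))) (link l) h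
    ... | inj₁ e = contradiction (injective (ℕₚ.≤-trans (ℕₚ.n≤1+n i) (ℕₚ.<⇒≤ l)) l e) λ ()
    ... | inj₂ (inj₁ e) = inj₁ (sym e)
    ... | inj₂ (inj₂ e) = inj₂ (sym e)

  open Chain

  singleton : ∀ {c} → Square c → Chain 0
  singleton {c} s = record
    { sq = λ _ → c ; square = λ _ → s ; link = λ () ; injective = λ { z≤n z≤n _ → refl } }

  cons : ∀ {m} (C : Chain m) {d} → Link (sq C 0) d → ¬ Member C d → Chain (suc m)
  cons {m} C {d} h new = record { sq = sq' ; square = square' ; link = link' ; injective = injective' }
    where
    sq' : ℕ → Point
    sq' zero = d
    sq' (suc i) = sq C i
    square' : ∀ {i} → i ≤ suc m → Square (sq' i)
    square' {zero} _ = proj₁ (proj₂ h)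
    square' {suc i} (s≤s l) = square C l
    link' : ∀ {i} → i < suc m → Link (sq' i) (sq' (suc i))
    link' {zero} _ = Link-sym h
    link' {suc i} (s≤s l) = link C l
    injective' : ∀ {i j} → i ≤ suc m → j ≤ suc m → sq' i ≡ sq' j → i ≡ j
    injective' {zero} {zero} _ _ _ = refl
    injective' {zero} {suc j} _ (s≤s l) e = contradiction (j , s≤s l , sym e) new
    injective' {suc i} {zero} (s≤s l) _ e = contradiction (i , s≤s l , e) new
    injective' {suc i} {suc j} (s≤s l) (s≤s l') e = cong suc (injective C l l' e)

  reverse : ∀ {m} → Chain m → Chain m
  reverse {m} C = record
    { sq = λ i → sq C (m ∸ i)
    ; square = λ {i} _ → square C (ℕₚ.m∸n≤m m i)
    ; link = link'
    ; injective = λ {i} {j} l l' e → ℕₚ.∸-cancelˡ-≡ l l' (injective C (ℕₚ.m∸n≤m m i) (ℕₚ.m∸n≤m m j) e)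
    }
    where
    link' : ∀ {i} → i < m → Link (sq C (m ∸ i)) (sq C (m ∸ suc i))
    link' {i} l = Link-sym (subst (λ k → Link (sq C (m ∸ suc i)) (sq C k)) (sym (ℕₚ.+-∸-assoc 1 l))
      (link C (subst (_≤ m) (ℕₚ.+-∸-assoc 1 l) (ℕₚ.m∸n≤m m i))))

  Extends : ∀ {m m'} → Chain m → Chain m' → Set
  Extends C C' = ∀ d → Member C d → Member C' d

  reverse-extends : ∀ {m} (C : Chain m) → Extends C (reverse C)
  reverse-extends {m} C d (i , s≤s l , e) =
    m ∸ i , s≤s (ℕₚ.m∸n≤m m i) , trans (cong (sq C) (ℕₚ.m∸[m∸n]≡n l)) e

  -- `R` contains every square outside the chain and shrinks with each square prepended, which
  -- bounds the growth. The far end stays fixed so that growth can be repeated after a reversal.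
  grow : ∀ n (R : List Point) → length R < n → ∀ {m} (C : Chain m) →
    (∀ d → Square d → Member C d ⊎ d ∈ R) →
    ∃[ m' ] Σ (Chain m') λ C' → Saturated C' (sq C' 0) × Extends C C' × sq C' m' ≡ sq C m
  grow (suc n) R (s≤s l) {m} C all with Any.any? (λ d → Link? (sq C 0) d ×-dec ¬? (Member? C d)) R
  ... | no none = m , C , saturated , (λ _ h → h) , refl
    where
    saturated : Saturated C (sq C 0)
    saturated d h with all d (proj₁ (proj₂ h)) | Member? C d
    ... | _ | yes d∈ = d∈
    ... | inj₁ d∈ | _ = d∈
    ... | inj₂ d∈R | no d∉ = contradiction (lose d∈R (h , d∉)) none
  ... | yes some with find some
  ...   | d , d∈R , h , new with grow n (filter (λ x → ¬? (x ≟ d)) R) shorter (cons C h new) all'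
    where
    shorter : length (filter (λ x → ¬? (x ≟ d)) R) < n
    shorter = ℕₚ.<-≤-trans (Listₚ.filter-notAll (λ x → ¬? (x ≟ d)) R (lose d∈R (λ ne → ne refl))) l
    all' : ∀ e → Square e → Member (cons C h new) e ⊎ e ∈ filter (λ x → ¬? (x ≟ d)) R
    all' e s with all e s | e ≟ d
    ... | _ | yes refl = inj₁ (0 , s≤s z≤n , refl)
    ... | inj₁ (i , l , eq) | no _ = inj₁ (suc i , s≤s l , eq)
    ... | inj₂ e∈R | no ne = inj₂ (∈-filter⁺ (λ x → ¬? (x ≟ d)) e∈R ne)
  ...     | m' , C' , sat , ext , last = m' , C' , sat , (λ e (i , l , eq) → ext e (suc i , s≤s l , eq)) , last

  maximal : ∀ {c} → Square c → ∃[ m ] Σ (Chain m) λ C → Saturated C (sq C 0) × Saturated C (sq C m)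
  maximal s with grow _ squares ℕₚ.≤-refl (singleton s) (λ d sd → inj₂ (Square⇒∈ sd))
  -- The saturated front of `C₁` is the last square of its reversal. The second growth keeps that
  -- square and only adds members, so it remains saturated.
  ... | m₁ , C₁ , sat₁ , _ , _ with grow _ squares ℕₚ.≤-refl (reverse C₁) (λ d sd → inj₂ (Square⇒∈ sd))
  ...   | m₂ , C₂ , sat₂ , ext₂ , last₂ = m₂ , C₂ , sat₂ ,
    λ d h → ext₂ d (reverse-extends C₁ d (sat₁ d
      (subst (λ c → Link c d) (trans last₂ (cong (sq C₁) (ℕₚ.n∸n≡0 m₁))) h)))

  -- A ring of squares: the cochain marks the edges crossing from the vertices
  -- shared by the first and the last square into the first two squares, so a
  -- walk once around the ring has total true.
  module Ring (cos : ConsistsOfSquares S) {m} (C : Chain m) (3≤m : 3 ≤ m) (closing : Link (sq C 0) (sq C m)) where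

    c₀ c₁ c₂ cₘ : Point
    c₀ = sq C 0
    c₁ = sq C 1
    c₂ = sq C 2
    cₘ = sq C m

    1≤m : 1 ≤ m
    1≤m = ℕₚ.≤-trans (s≤s z≤n) 3≤m
    2≤m : 2 ≤ m
    2≤m = ℕₚ.≤-trans (s≤s (s≤s z≤n)) 3≤m

    off : ∀ {i j} → i ≤ m → j ≤ m → i ≢ j → sq C i ≢ sq C j
    off l l' ne e = ne (injective C l l' e)

    -- With `3 ≤ m` these four squares are distinct, against `three-squares`.
    crowded : ∀ {p} → Corner c₀ p → Corner c₁ p → Corner c₂ p → ¬ Corner cₘ p
    crowded h₀ h₁ h₂ hₘ with three-squares (square C z≤n) (square C 1≤m) (square C 2≤m) (square C ℕₚ.≤-refl) h₀ h₁ h₂ hₘ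
    ... | here e = off z≤n 1≤m (λ ()) e
    ... | there (here e) = off z≤n 2≤m (λ ()) e
    ... | there (there (here e)) = off z≤n ℕₚ.≤-refl (ℕₚ.<⇒≢ 1≤m) e
    ... | there (there (there (here e))) = off 1≤m 2≤m (λ ()) e
    ... | there (there (there (there (here e)))) = off 1≤m ℕₚ.≤-refl (ℕₚ.<⇒≢ 2≤m) e
    ... | there (there (there (there (there (here e))))) = off 2≤m ℕₚ.≤-refl (ℕₚ.<⇒≢ 3≤m) e

    Seam : Point → Set
    Seam u = Corner c₀ u × Corner cₘ u

    Seam? : ∀ u → Dec (Seam u)
    Seam? u = Corner? c₀ u ×-dec Corner? cₘ u

    -- `c₁` is included because an edge shared by `c₀` and `c₁` may leave the seam. Marking the
    -- edges of both squares makes `κ` a potential on each.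
    Front : Point → Point → Set
    Front u v = (Corner c₀ u × Corner c₀ v) ⊎ (Corner c₁ u × Corner c₁ v)

    Front? : ∀ u v → Dec (Front u v)
    Front? u v = (Corner? c₀ u ×-dec Corner? c₀ v) ⊎-dec (Corner? c₁ u ×-dec Corner? c₁ v)

    κ : Point → Bool
    κ u = does (Seam? u)

    φ : Point → Point → Bool
    φ u v = does (Front? u v) ∧ (κ u xor κ v)

    open Cochain φ

    first-links : ∀ {d} → Link c₀ d → d ≡ c₁ ⊎ d ≡ cₘ
    first-links h with two-links (link C 1≤m) closing h
    ... | inj₁ e = contradiction e (off 1≤m ℕₚ.≤-refl (ℕₚ.<⇒≢ 2≤m))
    ... | inj₂ (inj₁ e) = inj₁ (sym e)
    ... | inj₂ (inj₂ e) = inj₂ (sym e)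

    -- A square sharing an edge with `c₀` is `c₁` or `cₘ`, and in `cₘ` the whole edge lies on the
    -- seam. One sharing an edge with `c₁` is `c₀` or `c₂`, and a seam vertex on `c₁` and `c₂` is
    -- excluded by `crowded`. Hence `φ` vanishes on all other squares.
    uncrossed : ∀ {d u v} → Square d → d ≢ c₀ → d ≢ c₁ → Corner d u → Corner d v → GAdj u v →
      Front u v → Seam u → Seam v
    uncrossed {d} {u} {v} s d≢c₀ d≢c₁ du dv uv (inj₁ (u₀ , v₀)) _ with shared-edge {c₀} {d} u₀ v₀ du dv uv
    ... | inj₁ e = contradiction (sym e) d≢c₀
    ... | inj₂ h with first-links (edge⇒Link (square C z≤n) s h)
    ...   | inj₁ e = contradiction e d≢c₁
    ...   | inj₂ e = v₀ , subst (λ c → Corner c v) e dv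
    uncrossed {d} {u} {v} s d≢c₀ d≢c₁ du dv uv (inj₂ (u₁ , v₁)) (u₀ , uₘ) with shared-edge {c₁} {d} u₁ v₁ du dv uv
    ... | inj₁ e = contradiction (sym e) d≢c₁
    ... | inj₂ h with interior C 2≤m (edge⇒Link (square C 1≤m) s h)
    ...   | inj₁ e = contradiction e d≢c₀
    ...   | inj₂ e = contradiction uₘ (crowded u₀ u₁ (subst (λ c → Corner c u) e du))

    φ-off : ∀ {d} → Square d → d ≢ c₀ → d ≢ c₁ → ∀ u v → Corner d u → Corner d v → GAdj u v → φ u v ≡ false
    φ-off {d} s n₀ n₁ u v du dv uv = unmarked (Front? u v) (Seam? u) (Seam? v)
      (uncrossed {d} {u} {v} s n₀ n₁ du dv uv)
      (λ f → uncrossed {d} {v} {u} s n₀ n₁ dv du (GAdj-sym {u} {v} uv) (Sum.map Product.swap Product.swap f))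
      where
      unmarked : ∀ {F A B : Set} (f? : Dec F) (a? : Dec A) (b? : Dec B) →
        (F → A → B) → (F → B → A) → does f? ∧ (does a? xor does b?) ≡ false
      unmarked (no _) _ _ _ _ = refl
      unmarked (yes _) (yes _) (yes _) _ _ = refl
      unmarked (yes _) (no _) (no _) _ _ = refl
      unmarked (yes f) (yes a) (no b) h _ = contradiction (h f a) b
      unmarked (yes f) (no a) (yes b) _ h = contradiction (h f b) a

    φ-front : ∀ u v → Front u v → φ u v ≡ κ u xor κ v
    φ-front u v f = cong (_∧ (κ u xor κ v)) (dec-true (Front? u v) f)

    exact : ∀ {c} → Square c → Σ (Point → Bool) λ χ → ∀ u v → Corner c u → Corner c v → GAdj u v → φ u v ≡ χ u xor χ v
    exact {c} s with c ≟ c₀ | c ≟ c₁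
    ... | yes refl | _ = κ , λ u v cu cv _ → φ-front u v (inj₁ (cu , cv))
    ... | no _ | yes refl = κ , λ u v cu cv _ → φ-front u v (inj₂ (cu , cv))
    ... | no n₀ | no n₁ = (λ _ → false) , φ-off s n₀ n₁

    within : ∀ {d} → Square d → (χ : Point → Bool) →
      (∀ u v → Corner d u → Corner d v → GAdj u v → φ u v ≡ χ u xor χ v) →
      ∀ {u v} → Corner d u → Corner d v → Σ (Walk S u v) λ w → total w ≡ χ u xor χ v
    within {d} s χ eq {u} {v} du dv with within-square {d} {u} {v} du dv
    ... | inj₁ h = there h (s v dv) here , trans (xor-identityʳ (φ u v)) (eq u v du dv h)
    ... | inj₂ (r , dr , h , h') = there h (s r dr) (there h' (s v dv) here) ,
      trans (cong₂ _xor_ (eq u r du dr h) (trans (xor-identityʳ (φ r v)) (eq r v dr dv h')))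
        (telescope (χ u) (χ r) (χ v))
      where
      telescope : ∀ a b c → (a xor b) xor (b xor c) ≡ a xor c
      telescope = solve 3 (λ a b c → (a :+ b) :+ (b :+ c) := a :+ c) refl
        where open xor-∧-Solver

    -- From index 2 on every square has the zero potential, so a walk through consecutive ones
    -- collects nothing.
    around : ∀ n {i u v} → 2 ≤ i → i ℕ.+ n ≤ m → Corner (sq C i) u → Corner (sq C (i ℕ.+ n)) v →
      Σ (Walk S u v) λ w → total w ≡ false
    around n {i} {u} {v} 2≤i l cu cv with ℕₚ.≤-trans (ℕₚ.m≤m+n i n) l
    ... | i≤m = go n l cv
      where
      here-within : ∀ {v} → Corner (sq C i) v → Σ (Walk S u v) λ w → total w ≡ false
      here-within = within (square C i≤m) (λ _ → false)
        (φ-off (square C i≤m) (off i≤m z≤n (λ e → ℕₚ.<⇒≢ (ℕₚ.≤-trans (s≤s z≤n) 2≤i) (sym e)))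
          (off i≤m 1≤m (λ e → ℕₚ.<⇒≢ 2≤i (sym e)))) cu
      go : ∀ n → i ℕ.+ n ≤ m → Corner (sq C (i ℕ.+ n)) v → Σ (Walk S u v) λ w → total w ≡ false
      go zero l cv = here-within (subst (λ k → Corner (sq C k) v) (ℕₚ.+-identityʳ i) cv)
      go (suc n) l cv with ℕₚ.+-suc i n
      ... | e with Link-corner (link C {i} (ℕₚ.≤-trans (s≤s (ℕₚ.m≤m+n i n)) (subst (_≤ m) e l)))
      ...   | x , xi , xi+1 with here-within xi
             | around n {suc i} (ℕₚ.≤-trans 2≤i (ℕₚ.n≤1+n i)) (subst (_≤ m) e l) xi+1
                 (subst (λ k → Corner (sq C k) v) e cv)
      ...     | w , tw | w' , tw' = w ++ʷ w' , trans (total-++ w w') (cong₂ _xor_ tw tw')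

    impossible : ⊥
    -- `k` is on the seam and, by `crowded`, `y` is not. The loop goes from `k` to `x` in `c₀`, on
    -- to `y` in `c₁`, and back through the remaining squares; its total is `κ k xor κ y`, which is
    -- true.
    impossible with Link-corner closing | Link-corner (link C 1≤m) | Link-corner (link C 2≤m)
    ... | k , k₀ , kₘ | x , x₀ , x₁ | y , y₁ , y₂
      with within (square C z≤n) κ (λ u v cu cv _ → φ-front u v (inj₁ (cu , cv))) k₀ x₀
         | within (square C 1≤m) κ (λ u v cu cv _ → φ-front u v (inj₂ (cu , cv))) x₁ y₁
         | around (m ∸ 2) {2} (s≤s (s≤s z≤n)) (ℕₚ.≤-reflexive (ℕₚ.m+[n∸m]≡n 2≤m)) y₂
             (subst (λ i → Corner (sq C i) k) (sym (ℕₚ.m+[n∸m]≡n 2≤m)) kₘ)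
    ... | w₀ , t₀ | w₁ , t₁ | w₂ , t₂ =
      absurd (κ x) (dec-true (Seam? k) (k₀ , kₘ))
        (dec-false (Seam? y) λ (y₀ , yₘ) → crowded y₀ y₁ y₂ yₘ)
        (trans (sym total≡) (Loops.total-loop S avoid cos φ exact _ (square C z≤n k k₀) (w₀ ++ʷ w₁ ++ʷ w₂) refl))
      where
      total≡ : total (w₀ ++ʷ w₁ ++ʷ w₂) ≡ (κ k xor κ x) xor ((κ x xor κ y) xor false)
      total≡ = trans (total-++ w₀ (w₁ ++ʷ w₂)) (cong₂ _xor_ t₀ (trans (total-++ w₁ w₂) (cong₂ _xor_ t₁ t₂)))
      absurd : ∀ {a c} b → a ≡ true → c ≡ false → (a xor b) xor ((b xor c) xor false) ≢ false
      absurd false refl refl ()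
      absurd true refl refl ()

  module Contiguous (connected : Connected S) (cos : ConsistsOfSquares S) {m} (C : Chain m)
    (sat₀ : Saturated C (sq C 0)) (satₘ : Saturated C (sq C m)) where

    saturated : ∀ {c} → Member C c → Saturated C c
    saturated (zero , _ , refl) = sat₀
    saturated (suc i , s≤s l , refl) d h with suc i ℕ.≟ m
    ... | yes refl = satₘ d h
    ... | no ne with interior C (ℕₚ.≤∧≢⇒< l ne) h
    ...   | inj₁ e = i , ℕₚ.≤-trans l (ℕₚ.n≤1+n m) , sym e
    ...   | inj₂ e = suc (suc i) , s≤s (ℕₚ.≤∧≢⇒< l ne) , sym e

    member⇒square : ∀ {c} → Member C c → Square c
    member⇒square (i , s≤s l , refl) = square C l

    neighbour : ∀ {c d p} → Member C c → Square d → Corner c p → Corner d p → Member C d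
    neighbour {c} {d} {p} c∈ s cp dp with touching⇒Link {c} {d} {p} (member⇒square c∈) s cp dp
    ... | inj₁ refl = c∈
    ... | inj₂ (inj₁ h) = saturated c∈ d h
    ... | inj₂ (inj₂ (e , _ , h , h')) = saturated (saturated c∈ e h) d h'

    -- The invariant along a walk is that every square at the current vertex belongs to the chain.
    -- It crosses an edge because the edge lies in some square, and squares at a common vertex are
    -- reached by links.
    complete : ∀ {d} → Square d → Member C d
    complete {d} s = all-at (connected (sq C 0) d (square C z≤n _ (inj₁ refl)) (s d (inj₁ refl)))
      (square C z≤n _ (inj₁ refl)) (λ s' h → neighbour (0 , s≤s z≤n , refl) s' (inj₁ refl) h) s (inj₁ refl)
      where
      all-at : ∀ {p q} → Walk S p q → p ∈ S →
        (∀ {d} → Square d → Corner d p → Member C d) → ∀ {d} → Square d → Corner d q → Member C d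
      all-at here _ base = base
      all-at {p} (there {q = q} h q∈ w) p∈ base with proj₂ cos p q p∈ q∈ h
      ... | c , sc , cp , cq = all-at w q∈ λ s dq → neighbour (base sc cp) s cq dq

    no-ring : 2 ≤ m → ¬ Link (sq C 0) (sq C m)
    no-ring 2≤m closing with 3 ℕ.≤? m
    ... | yes 3≤m = Ring.impossible cos C 3≤m closing
    ... | no m<3 with ℕₚ.≤-antisym 2≤m (ℕₚ.≤-pred (ℕₚ.≰⇒> m<3))
    -- Three squares are too few for `Ring`, which needs four distinct ones.
    ...   | refl = no-link-triangle (link C (s≤s z≤n)) (link C (s≤s (s≤s z≤n))) closing

    forward : ∀ {i j} → i < j → j ≤ m → Link (sq C i) (sq C j) → suc i ≡ j
    forward {suc i} {j} l l' h with interior C (ℕₚ.<-≤-trans l l') h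
    ... | inj₁ e = contradiction (injective C l' (ℕₚ.≤-trans (ℕₚ.n≤1+n i) (ℕₚ.≤-trans (ℕₚ.<⇒≤ l) l')) e)
                     (λ e' → ℕₚ.<⇒≢ (ℕₚ.<-trans (ℕₚ.n<1+n i) l) (sym e'))
    ... | inj₂ e = sym (injective C l' (ℕₚ.<-≤-trans l l') e)
    forward {zero} {suc zero} _ _ _ = refl
    forward {zero} {suc (suc j)} _ l' h with suc (suc j) ℕ.≟ m
    ... | yes refl = contradiction h (no-ring (s≤s (s≤s z≤n)))
    ... | no ne with interior C (ℕₚ.≤∧≢⇒< l' ne) (Link-sym h)
    ...   | inj₁ e = contradiction (injective C z≤n (ℕₚ.≤-trans (ℕₚ.n≤1+n (suc j)) l') e) λ ()
    ...   | inj₂ e = contradiction (injective C z≤n (ℕₚ.≤∧≢⇒< l' ne) e) λ ()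

    consecutive : ∀ {i j} → i ≤ m → j ≤ m → Link (sq C i) (sq C j) → suc i ≡ j ⊎ suc j ≡ i
    consecutive {i} {j} l l' h with ℕₚ.<-cmp i j
    ... | tri< i<j _ _ = inj₁ (forward i<j l' h)
    ... | tri≈ _ refl _ = contradiction refl (Link⇒≢ h)
    ... | tri> _ _ j<i = inj₂ (forward j<i l (Link-sym h))

    -- Two squares at `p` are equal, linked, or linked through a third square at `p`. Links join
    -- only consecutive indices, so `k` is at most `i + 2`, and in the extreme case the middle
    -- square is that third one.
    contiguous : ∀ {i j k p} → i ≤ j → j ≤ k → k ≤ m →
      Corner (sq C i) p → Corner (sq C k) p → Corner (sq C j) p
    contiguous {i} {j} {k} {p} i≤j j≤k k≤m ip kp =
      conclude (touching⇒Link {sq C i} {sq C k} {p} (square C i≤m) (square C k≤m) ip kp)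
      where
      i≤m : i ≤ m
      i≤m = ℕₚ.≤-trans i≤j (ℕₚ.≤-trans j≤k k≤m)
      between : ∀ {i k} → i ≤ j → j ≤ k → k ≤ suc i → j ≡ i ⊎ j ≡ k
      between {i} {k} a b c with j ℕ.≟ i
      ... | yes e = inj₁ e
      ... | no ne = inj₂ (ℕₚ.≤-antisym b (ℕₚ.≤-trans c (ℕₚ.≤∧≢⇒< a (λ e → ne (sym e)))))
      at-ends : j ≡ i ⊎ j ≡ k → Corner (sq C j) p
      at-ends (inj₁ refl) = ip
      at-ends (inj₂ refl) = kp
      near : k ≤ suc i → Corner (sq C j) p
      near h = at-ends (between i≤j j≤k h)
      conclude : sq C i ≡ sq C k ⊎ Link (sq C i) (sq C k) ⊎ (∃[ e ] (Corner e p × Link (sq C i) e × Link e (sq C k))) →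
        Corner (sq C j) p
      conclude (inj₁ e) = near (ℕₚ.≤-trans (ℕₚ.≤-reflexive (sym (injective C i≤m k≤m e))) (ℕₚ.n≤1+n i))
      conclude (inj₂ (inj₁ h)) with consecutive i≤m k≤m h
      ... | inj₁ e = near (ℕₚ.≤-reflexive (sym e))
      ... | inj₂ e = near (ℕₚ.≤-trans (ℕₚ.n≤1+n k) (ℕₚ.≤-trans (ℕₚ.≤-reflexive e) (ℕₚ.n≤1+n i)))
      conclude (inj₂ (inj₂ (e , ep , h , h'))) with complete (proj₁ h')
      ... | l , s≤s l≤m , refl with consecutive i≤m l≤m h | consecutive l≤m k≤m h'
      ...   | inj₁ refl | inj₂ refl = near (ℕₚ.n≤1+n i)
      ...   | inj₂ refl | inj₁ refl = near (ℕₚ.n≤1+n i)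
      ...   | inj₂ refl | inj₂ refl = near (ℕₚ.≤-trans (ℕₚ.n≤1+n k) (ℕₚ.≤-trans (ℕₚ.n≤1+n (suc k)) (ℕₚ.n≤1+n _)))
      ...   | inj₁ refl | inj₁ refl with j ℕ.≟ suc i
      ...     | yes refl = ep
      ...     | no ne with j ℕ.≤? i
      ...       | yes j≤i = at-ends (inj₁ (ℕₚ.≤-antisym j≤i i≤j))
      ...       | no j≰i = at-ends (inj₂ (ℕₚ.≤-antisym j≤k (ℕₚ.≤∧≢⇒< (ℕₚ.≰⇒> j≰i) (λ e → ne (sym e)))))

-- Order of occurrences in a word.

-- The inductive counterpart of `Occ12`, over any type, so that the word can first be built from
-- points and then mapped to labels.
data Precedes {A : Set} (a b : A) : List A → Set where
  here  : ∀ {xs} → b ∈ xs → Precedes a b (a ∷ xs)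
  there : ∀ {x xs} → Precedes a b xs → Precedes a b (x ∷ xs)

module _ {A : Set} {a b : A} where

  precedes-∈ˡ : ∀ {xs} → Precedes a b xs → a ∈ xs
  precedes-∈ˡ (here _) = here refl
  precedes-∈ˡ (there h) = there (precedes-∈ˡ h)

  precedes-∈ʳ : ∀ {xs} → Precedes a b xs → b ∈ xs
  precedes-∈ʳ (here m) = there m
  precedes-∈ʳ (there h) = there (precedes-∈ʳ h)

  precedes-++⁺ˡ : ∀ {xs} ys → Precedes a b xs → Precedes a b (xs ++ ys)
  precedes-++⁺ˡ ys (here m) = here (∈-++⁺ˡ m)
  precedes-++⁺ˡ ys (there h) = there (precedes-++⁺ˡ ys h)

  precedes-++⁺ʳ : ∀ xs {ys} → Precedes a b ys → Precedes a b (xs ++ ys)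
  precedes-++⁺ʳ [] h = h
  precedes-++⁺ʳ (_ ∷ xs) h = there (precedes-++⁺ʳ xs h)

  precedes-++⁺ : ∀ {xs ys} → a ∈ xs → b ∈ ys → Precedes a b (xs ++ ys)
  precedes-++⁺ {_ ∷ xs} (here refl) m = here (∈-++⁺ʳ xs m)
  precedes-++⁺ (there m) m' = there (precedes-++⁺ m m')

  precedes-++⁻ : ∀ xs {ys} → Precedes a b (xs ++ ys) → Precedes a b xs ⊎ (a ∈ xs × b ∈ ys) ⊎ Precedes a b ys
  precedes-++⁻ [] h = inj₂ (inj₂ h)
  precedes-++⁻ (x ∷ xs) (here m) with ∈-++⁻ xs m
  ... | inj₁ m' = inj₁ (here m')
  ... | inj₂ m' = inj₂ (inj₁ (here refl , m'))
  precedes-++⁻ (x ∷ xs) (there h) with precedes-++⁻ xs h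
  ... | inj₁ h' = inj₁ (there h')
  ... | inj₂ (inj₁ (m , m')) = inj₂ (inj₁ (there m , m'))
  ... | inj₂ (inj₂ h') = inj₂ (inj₂ h')

  precedes-pairs : ∀ {R : A → A → Set} {xs} → AllPairs R xs → Precedes a b xs → R a b
  precedes-pairs (h ∷ _) (here m) = All.lookup h m
  precedes-pairs (_ ∷ hs) (there k) = precedes-pairs hs k

  precedes-total : ∀ {xs} → a ∈ xs → b ∈ xs → a ≢ b → Precedes a b xs ⊎ Precedes b a xs
  precedes-total (here refl) (here refl) ne = contradiction refl ne
  precedes-total (here refl) (there m) _ = inj₁ (here m)
  precedes-total (there m) (here refl) _ = inj₂ (here m)
  precedes-total (there m) (there m') ne with precedes-total m m' ne
  ... | inj₁ h = inj₁ (there h)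
  ... | inj₂ h = inj₂ (there h)

precedes-map⁺ : ∀ {A B : Set} (f : A → B) {a b xs} → Precedes a b xs → Precedes (f a) (f b) (map f xs)
precedes-map⁺ f (here m) = here (∈-map⁺ f m)
precedes-map⁺ f (there h) = there (precedes-map⁺ f h)

precedes-map⁻ : ∀ {A B : Set} (f : A → B) {a b} xs →
  (∀ {x} → x ∈ xs → f x ≡ f a → x ≡ a) → (∀ {x} → x ∈ xs → f x ≡ f b → x ≡ b) →
  Precedes (f a) (f b) (map f xs) → Precedes a b xs
precedes-map⁻ f {a} {b} (x ∷ xs) inj-a inj-b h = go refl h
  where
  go : ∀ {y} → y ≡ f x → Precedes (f a) (f b) (y ∷ map f xs) → Precedes a b (x ∷ xs)
  go e (here m) with ∈-map⁻ f m
  ... | z , z∈ , e' with inj-a (here refl) (sym e) | inj-b (there z∈) (sym e')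
  ...   | refl | refl = here z∈
  go e (there h) = there (precedes-map⁻ f xs (λ m → inj-a (there m)) (λ m → inj-b (there m)) h)

Occ12⇒Precedes : ∀ {w a b} → Occ12 w a b → Precedes a b w
Occ12⇒Precedes {x ∷ w} (Fin.zero , Fin.suc j , _ , refl , refl) = here (∈-lookup j)
Occ12⇒Precedes {x ∷ w} (Fin.suc i , Fin.suc j , s≤s l , e , e') = there (Occ12⇒Precedes (i , j , l , e , e'))

Precedes⇒Occ12 : ∀ {w a b} → Precedes a b w → Occ12 w a b
Precedes⇒Occ12 (here m) = Fin.zero , Fin.suc (index m) , s≤s z≤n , refl , sym (lookup-index m)
Precedes⇒Occ12 (there h) with Precedes⇒Occ12 h
... | i , j , l , e , e' = Fin.suc i , Fin.suc j , s≤s l , e , e'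

module _ (f : Point → ℕ) where

  private
    order : DecTotalOrder _ _ _
    order = On.decTotalOrder ℕₚ.≤-decTotalOrder f

  sortBy : List Point → List Point
  sortBy = Sort.sort order

  sortBy-∈⁺ : ∀ {p xs} → p ∈ xs → p ∈ sortBy xs
  sortBy-∈⁺ {xs = xs} = ∈-resp-↭ (↭-sym (Sort.sort-↭ order xs))

  sortBy-∈⁻ : ∀ {p xs} → p ∈ sortBy xs → p ∈ xs
  sortBy-∈⁻ {xs = xs} = ∈-resp-↭ (Sort.sort-↭ order xs)

  precedes-sortBy⁻ : ∀ {p q xs} → Precedes p q (sortBy xs) → f p ≤ f q
  precedes-sortBy⁻ {xs = xs} = precedes-pairs (Linked⇒AllPairs ℕₚ.≤-trans (Sort.sort-↗ order xs))

  precedes-sortBy⁺ : ∀ {p q xs} → p ∈ xs → q ∈ xs → f p < f q → Precedes p q (sortBy xs)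
  precedes-sortBy⁺ {p} {q} {xs} p∈ q∈ l with precedes-total (sortBy-∈⁺ p∈) (sortBy-∈⁺ q∈) (λ e → ℕₚ.<⇒≢ l (cong f e))
  ... | inj₁ h = h
  ... | inj₂ h = contradiction l (ℕₚ.≤⇒≯ (precedes-sortBy⁻ {xs = xs} h))

-- Labels and a word from intervals.

position : List Point → Point → ℕ
position [] p = 0
position (x ∷ xs) p with x ≟ p
... | yes _ = 0
... | no _ = suc (position xs p)

position-injective : ∀ {S p q} → p ∈ S → q ∈ S → position S p ≡ position S q → p ≡ q
position-injective {x ∷ S} {p} {q} p∈ q∈ e with x ≟ p | x ≟ q
... | yes refl | yes refl = refl
... | no n | no n' = position-injective (tail n p∈) (tail n' q∈) (ℕₚ.suc-injective e)
  where
  tail : ∀ {r} → x ≢ r → r ∈ x ∷ S → r ∈ S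
  tail n (here refl) = contradiction refl n
  tail n (there m) = m

position-≤ : ∀ S p → position S p ≤ length S
position-≤ [] p = z≤n
position-≤ (x ∷ S) p with x ≟ p
... | yes _ = z≤n
... | no _ = s≤s (position-≤ S p)

-- Each even vertex a and odd vertex b get an interval [s , t], and they are
-- adjacent iff s a ≤ t b and s b ≤ t a.  The labels decide the first condition, the
-- middle part of the word the second one; the odd vertices in front and the
-- even ones at the end supply the pattern 12 for all other pairs.
module Words (S : List Point) (s t : Point → ℕ)
  (overlap⁺ : ∀ {p q} → p ∈ S → q ∈ S → GAdj p q → s p ≤ t q)
  (overlap⁻ : ∀ {p q} → p ∈ S → q ∈ S → parity p ≡ false → parity q ≡ true →
    s p ≤ t q → s q ≤ t p → GAdj p q) where

  -- Doubling turns `s p ≤ t q` into `2 * s p < suc (2 * t q)`, so even and odd vertices never tie.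
  -- `key` compares even starts with odd ends, and `mid` compares odd starts with even ends.
  key mid : Point → ℕ
  key p = if parity p then suc (2 * t p) else 2 * s p
  mid p = if parity p then 2 * s p else suc (2 * t p)

  -- A two-digit number in base `suc (length S)`: the high digit is `key`, the low digit breaks
  -- ties, and the successor makes it positive.
  label : Point → ℕ
  label p = suc (position S p ℕ.+ key p * suc (length S))

  label-mono : ∀ {p q} → key p < key q → label p < label q
  label-mono {p} {q} l = s≤s (ℕₚ.≤-trans
    (ℕₚ.+-monoˡ-≤ (key p * N) (s≤s (position-≤ S p)))
    (ℕₚ.≤-trans (ℕₚ.*-monoˡ-≤ N l) (ℕₚ.m≤n+m (key q * N) (position S q))))
    where
    N = suc (length S)

  label-injective : ∀ {p q} → p ∈ S → q ∈ S → label p ≡ label q → p ≡ q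
  label-injective {p} {q} p∈ q∈ e with ℕₚ.<-cmp (key p) (key q)
  ... | tri< l _ _ = contradiction e (ℕₚ.<⇒≢ (label-mono {p} {q} l))
  ... | tri> _ _ l = contradiction (sym e) (ℕₚ.<⇒≢ (label-mono {q} {p} l))
  ... | tri≈ _ k _ = position-injective p∈ q∈ (ℕₚ.+-cancelʳ-≡ (key q * suc (length S)) _ _
    (trans (cong (λ k → position S p ℕ.+ k * suc (length S)) (sym k)) (ℕₚ.suc-injective e)))

  <-double : ∀ {m n} → m ≤ n → 2 * m < suc (2 * n)
  <-double l = s≤s (ℕₚ.*-monoʳ-≤ 2 l)

  double-< : ∀ {m n} → n < m → suc (2 * n) < 2 * m
  double-< {m} {n} l = ℕₚ.≤-trans (ℕₚ.≤-reflexive (cong suc (sym (ℕₚ.+-suc n (n ℕ.+ 0))))) (ℕₚ.*-monoʳ-≤ 2 l)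

  Odd? : ∀ p → Dec (parity p ≡ true)
  Odd? p = parity p Boolₚ.≟ true
  Even? : ∀ p → Dec (parity p ≡ false)
  Even? p = parity p Boolₚ.≟ false

  odds evens middle points-word : List Point
  odds = filter Odd? S
  evens = filter Even? S
  middle = sortBy mid S
  points-word = odds ++ middle ++ evens

  word : List ℕ
  word = map label points-word

  point-∈ : ∀ {p} → p ∈ S → p ∈ points-word
  point-∈ p∈ = ∈-++⁺ʳ odds (∈-++⁺ˡ (sortBy-∈⁺ mid p∈))

  ∈-point : ∀ {p} → p ∈ points-word → p ∈ S
  ∈-point m with ∈-++⁻ odds m
  ... | inj₁ o = proj₁ (∈-filter⁻ Odd? o)
  ... | inj₂ m' with ∈-++⁻ middle m'
  ...   | inj₁ c = sortBy-∈⁻ mid c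
  ...   | inj₂ e = proj₁ (∈-filter⁻ Even? {xs = S} e)

  odd-∈ : ∀ {p} → p ∈ odds → parity p ≡ true
  odd-∈ m = proj₂ (∈-filter⁻ Odd? {xs = S} m)

  even-∈ : ∀ {p} → p ∈ evens → parity p ≡ false
  even-∈ m = proj₂ (∈-filter⁻ Even? {xs = S} m)

  -- No even vertex stands in the prefix and no odd one in the suffix.
  middle-precedes : ∀ {p q} → parity p ≡ false → parity q ≡ true → Precedes p q points-word → Precedes p q middle
  middle-precedes {p} {q} ep oq h with precedes-++⁻ odds h
  ... | inj₁ k = contradiction (trans (sym ep) (odd-∈ (precedes-∈ˡ k))) λ ()
  ... | inj₂ (inj₁ (m , _)) = contradiction (trans (sym ep) (odd-∈ m)) λ ()
  ... | inj₂ (inj₂ k) with precedes-++⁻ middle k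
  ...   | inj₁ k' = k'
  ...   | inj₂ (inj₁ (_ , m)) = contradiction (trans (sym oq) (even-∈ m)) λ ()
  ...   | inj₂ (inj₂ k') = contradiction (trans (sym oq) (even-∈ (precedes-∈ʳ k'))) λ ()

  middle-order : ∀ {p q} → p ∈ S → q ∈ S → parity p ≡ false → parity q ≡ true →
    label p < label q → (¬ GAdj p q) ⇔ Precedes p q points-word
  middle-order {p} {q} p∈ q∈ ep oq l = mk⇔ to from
    where
    key-p : key p ≡ 2 * s p
    key-p = cong (λ b → if b then suc (2 * t p) else 2 * s p) ep
    key-q : key q ≡ suc (2 * t q)
    key-q = cong (λ b → if b then suc (2 * t q) else 2 * s q) oq
    mid-p : mid p ≡ suc (2 * t p)
    mid-p = cong (λ b → if b then 2 * s p else suc (2 * t p)) ep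
    mid-q : mid q ≡ 2 * s q
    mid-q = cong (λ b → if b then 2 * s q else suc (2 * t q)) oq
    sp≤tq : s p ≤ t q
    sp≤tq = ℕₚ.≮⇒≥ λ k → ℕₚ.<-asym l (label-mono {q} {p} (subst₂ _<_ (sym key-q) (sym key-p) (double-< k)))
    to : ¬ GAdj p q → Precedes p q points-word
    to nadj = precedes-++⁺ʳ odds (precedes-++⁺ˡ evens (precedes-sortBy⁺ mid p∈ q∈
      (subst₂ _<_ (sym mid-p) (sym mid-q) (double-< (ℕₚ.≰⇒> λ k → nadj (overlap⁻ p∈ q∈ ep oq sp≤tq k))))))
    from : Precedes p q points-word → ¬ GAdj p q
    from h adj = ℕₚ.<⇒≱ (<-double (overlap⁺ q∈ p∈ (GAdj-sym {p} {q} adj)))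
      (subst₂ _≤_ mid-p mid-q (precedes-sortBy⁻ mid {xs = S} (middle-precedes ep oq h)))

  same-parity : ∀ {p q} → parity p ≡ parity q → ¬ GAdj p q
  same-parity {p} {q} e h = Boolₚ.not-¬ (sym e) (parity-adj {p} {q} h)

  always : ∀ {P Q : Set} → P → Q → P ⇔ Q
  always p q = mk⇔ (λ _ → q) (λ _ → p)

  nonadjacent⇔ : ∀ {p q} → p ∈ S → q ∈ S → label p < label q → (¬ GAdj p q) ⇔ Precedes p q points-word
  nonadjacent⇔ {p} {q} p∈ q∈ l = go _ _ refl refl
    where
    go : ∀ b c → parity p ≡ b → parity q ≡ c → (¬ GAdj p q) ⇔ Precedes p q points-word
    go false true ep oq = middle-order p∈ q∈ ep oq l
    go false false ep eq = always (same-parity {p} {q} (trans ep (sym eq)))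
      (precedes-++⁺ʳ odds (precedes-++⁺ (sortBy-∈⁺ mid p∈) (∈-filter⁺ Even? q∈ eq)))
    go true true op oq = always (same-parity {p} {q} (trans op (sym oq)))
      (precedes-++⁺ (∈-filter⁺ Odd? p∈ op) (∈-++⁺ˡ (sortBy-∈⁺ mid q∈)))
    -- An edge would give `s q ≤ t p`, that is `key q < key p`, against the order of the labels.
    go true false op eq = always
      (λ adj → ℕₚ.<-asym l (label-mono {q} {p} (subst₂ _<_
        (sym (cong (λ b → if b then suc (2 * t q) else 2 * s q) eq))
        (sym (cong (λ b → if b then suc (2 * t p) else 2 * s p) op))
        (<-double (overlap⁺ q∈ p∈ (GAdj-sym {p} {q} adj))))))
      (precedes-++⁺ (∈-filter⁺ Odd? p∈ op) (∈-++⁺ʳ middle (∈-filter⁺ Even? q∈ eq)))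

  ordered : ∀ {p q} → p ∈ S → q ∈ S → label p < label q → (¬ GAdj p q) ⇔ Has12 word (label p) (label q)
  ordered {p} {q} p∈ q∈ l = subst₂ (λ a b → (¬ GAdj p q) ⇔ Occ12 word a b)
    (sym (ℕₚ.m≤n⇒m⊓n≡m (ℕₚ.<⇒≤ l))) (sym (ℕₚ.m≤n⇒m⊔n≡n (ℕₚ.<⇒≤ l)))
    (mk⇔ (λ h → Precedes⇒Occ12 (precedes-map⁺ label (Equivalence.to (nonadjacent⇔ p∈ q∈ l) h)))
         (λ h → Equivalence.from (nonadjacent⇔ p∈ q∈ l) (precedes-map⁻ label points-word
           (λ m → label-injective (∈-point m) p∈) (λ m → label-injective (∈-point m) q∈) (Occ12⇒Precedes h))))

  representable : TwelveRepresentable S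
  representable = label , ((λ p _ → s≤s z≤n) , λ p q → label-injective) , word ,
    letters , (λ p p∈ → ∈-map⁺ label (point-∈ p∈)) , pairs
    where
    letters : ∀ a → a ∈ word → ∃[ p ] (p ∈ S × label p ≡ a)
    letters a m with ∈-map⁻ label m
    ... | p , p∈ , e = p , ∈-point p∈ , sym e
    pairs : ∀ p q → p ∈ S → q ∈ S → p ≢ q → (¬ GAdj p q) ⇔ Has12 word (label p) (label q)
    pairs p q p∈ q∈ ne with ℕₚ.<-cmp (label p) (label q)
    ... | tri< l _ _ = ordered p∈ q∈ l
    ... | tri≈ _ e _ = contradiction (label-injective p∈ q∈ e) ne
    ... | tri> _ _ l = mk⇔
      (λ h → subst₂ (Occ12 word) (ℕₚ.⊓-comm (label q) (label p)) (ℕₚ.⊔-comm (label q) (label p))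
        (Equivalence.to (ordered q∈ p∈ l) λ adj → h (GAdj-sym {q} {p} adj)))
      (λ h adj → Equivalence.from (ordered q∈ p∈ l)
        (subst₂ (Occ12 word) (ℕₚ.⊓-comm (label p) (label q)) (ℕₚ.⊔-comm (label p) (label q)) h) (GAdj-sym {p} {q} adj))

-- The interval of squares at each vertex.

module _ {P : ℕ → Set} (P? : ∀ i → Dec (P i)) where

  -- Index 0 is the untested default, as the bound is in `first`; the `-satisfies` lemmas therefore
  -- ask for some index where `P` holds.
  last : ℕ → ℕ
  last zero = zero
  last (suc n) with P? (suc n)
  ... | yes _ = suc n
  ... | no _ = last n

  last-satisfies : ∀ {n i} → i ≤ n → P i → P (last n)
  last-satisfies {zero} z≤n h = h
  last-satisfies {suc n} l h with P? (suc n)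
  ... | yes h' = h'
  ... | no ¬h = last-satisfies (ℕₚ.≤-pred (ℕₚ.≤∧≢⇒< l λ { refl → ¬h h })) h

  last-≥ : ∀ {n i} → i ≤ n → P i → i ≤ last n
  last-≥ {zero} l h = l
  last-≥ {suc n} l h with P? (suc n)
  ... | yes h' = l
  ... | no ¬h = last-≥ (ℕₚ.≤-pred (ℕₚ.≤∧≢⇒< l λ { refl → ¬h h })) h

  last-≤ : ∀ n → last n ≤ n
  last-≤ zero = z≤n
  last-≤ (suc n) with P? (suc n)
  ... | yes h' = ℕₚ.≤-refl
  ... | no ¬h = ℕₚ.≤-trans (last-≤ n) (ℕₚ.n≤1+n n)

first : ∀ {P : ℕ → Set} → (∀ i → Dec (P i)) → ℕ → ℕ
first P? zero = zero
first P? (suc n) with P? 0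
... | yes _ = zero
... | no _ = suc (first (λ i → P? (suc i)) n)

first-satisfies : ∀ {P : ℕ → Set} (P? : ∀ i → Dec (P i)) {n i} → i ≤ n → P i → P (first P? n)
first-satisfies P? {zero} z≤n h = h
first-satisfies P? {suc n} {i} l h with P? 0 | i | l
... | yes h' | _ | _ = h'
... | no ¬h | zero | _ = contradiction h ¬h
... | no ¬h | suc i | s≤s l = first-satisfies (λ i → P? (suc i)) l h

first-≤ : ∀ {P : ℕ → Set} (P? : ∀ i → Dec (P i)) {n i} → i ≤ n → P i → first P? n ≤ i
first-≤ P? {zero} l h = z≤n
first-≤ P? {suc n} {i} l h with P? 0 | i | l
... | yes h' | _ | _ = z≤n
... | no ¬h | zero | _ = contradiction h ¬h
... | no ¬h | suc i | s≤s l = s≤s (first-≤ (λ i → P? (suc i)) l h)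

module Strip (S : List Point) (avoid : FAvoiding S) (connected : Connected S) (cos : ConsistsOfSquares S)
  where
  open Squares S
  open Chains S avoid
  open Chain

  module Intervals {m} (C : Chain m) (sat₀ : Saturated C (sq C 0)) (satₘ : Saturated C (sq C m)) where
    open Contiguous connected cos C sat₀ satₘ

    Covers? : ∀ p i → Dec (Corner (sq C i) p)
    Covers? p i = Corner? (sq C i) p

    s t : Point → ℕ
    s p = first (Covers? p) m
    t p = last (Covers? p) m

    covering : ∀ {p} → p ∈ S → ∃[ i ] (i ≤ m × Corner (sq C i) p)
    covering {p} p∈ with proj₁ cos p p∈
    ... | c , sc , cp with complete sc
    ...   | i , s≤s l , refl = i , l , cp

    overlap⁺ : ∀ {p q} → p ∈ S → q ∈ S → GAdj p q → s p ≤ t q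
    overlap⁺ {p} {q} p∈ q∈ adj with proj₂ cos p q p∈ q∈ adj
    ... | c , sc , cp , cq with complete sc
    ...   | i , s≤s l , refl = ℕₚ.≤-trans (first-≤ (Covers? p) l cp) (last-≥ (Covers? q) l cq)

    between : ∀ {p j} → p ∈ S → s p ≤ j → j ≤ t p → Corner (sq C j) p
    between {p} p∈ l l' with covering p∈
    ... | i , i≤m , cp = contiguous l l' (last-≤ (Covers? p) m)
      (first-satisfies (Covers? p) i≤m cp) (last-satisfies (Covers? p) i≤m cp)

    s≤t : ∀ {p} → p ∈ S → s p ≤ t p
    s≤t {p} p∈ with covering p∈
    ... | i , i≤m , cp = ℕₚ.≤-trans (first-≤ (Covers? p) i≤m cp) (last-≥ (Covers? p) i≤m cp)

    -- Two intervals that meet share the larger of their starts, so both vertices lie on that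
    -- square; opposite parity then leaves only adjacency.
    overlap⁻ : ∀ {p q} → p ∈ S → q ∈ S → parity p ≡ false → parity q ≡ true →
      s p ≤ t q → s q ≤ t p → GAdj p q
    overlap⁻ {p} {q} p∈ q∈ ep oq l l' with within-square {sq C (s p ⊔ s q)} {p} {q}
      (between p∈ (ℕₚ.m≤m⊔n (s p) (s q)) (ℕₚ.⊔-lub (s≤t p∈) l'))
      (between q∈ (ℕₚ.m≤n⊔m (s p) (s q)) (ℕₚ.⊔-lub l (s≤t q∈)))
    ... | inj₁ adj = adj
    ... | inj₂ (r , _ , h , h') = contradiction
      (trans (sym oq) (trans (parity-adj {r} {q} h') (cong not (trans (parity-adj {p} {r} h) (cong not ep))))) λ ()

    representable : TwelveRepresentable S
    representable = Words.representable S s t overlap⁺ overlap⁻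

  nonempty-representable : ∀ {c} → Square c → TwelveRepresentable S
  nonempty-representable sc = let m , C , sat₀ , satₘ = maximal sc in Intervals.representable C sat₀ satₘ

avoiding⇒representable : ∀ S → SquareGridGraph S → FAvoiding S → TwelveRepresentable S
avoiding⇒representable [] _ _ = (λ _ → 1) , ((λ _ ()) , λ _ _ ()) , [] , (λ _ ()) , (λ _ ()) , λ _ _ ()
avoiding⇒representable S@(p ∷ _) (connected , cos) avoid =
  Strip.nonempty-representable S avoid connected cos (proj₁ (proj₂ (proj₁ cos p (here refl))))

-- The 2+2-freeness of interval orders.
precedes-exchange : ∀ {A : Set} {a b c d : A} {xs} → Precedes a b xs → Precedes c d xs →
  Precedes a d xs ⊎ Precedes c b xs
precedes-exchange (here m) h = inj₁ (reach h)
  where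
  reach : ∀ {A : Set} {a c d : A} {xs} → Precedes c d (a ∷ xs) → Precedes a d (a ∷ xs)
  reach (here m) = here m
  reach (there h) = here (precedes-∈ʳ h)
precedes-exchange (there h) (here m) = inj₂ (here (precedes-∈ʳ h))
precedes-exchange (there h) (there h') with precedes-exchange h h'
... | inj₁ k = inj₁ (there k)
... | inj₂ k = inj₂ (there k)

-- An occurrence of `c` lies either after the chosen `a`, or at it or before it and hence before
-- `b`.
precedes-split : ∀ {A : Set} {a b c : A} {xs} → Precedes a b xs → c ∈ xs → Precedes a c xs ⊎ Precedes c b xs
precedes-split (here m) (here refl) = inj₂ (here m)
precedes-split (here m) (there m') = inj₁ (here m')
precedes-split (there h) (here refl) = inj₂ (here (precedes-∈ʳ h))
precedes-split (there h) (there m) with precedes-split h m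
... | inj₁ k = inj₁ (there k)
... | inj₂ k = inj₂ (there k)

-- Sources, sinks and the left/right relation of a represented graph.

module Representation (S : List Point) (ℓ : Point → ℕ) (labeling : IsLabeling S ℓ)
  (w : List ℕ) (rep : Represents S ℓ w) where

  Edge : Point → Point → Set
  Edge u v = u ∈ S × v ∈ S × GAdj u v

  Edge-sym : ∀ {u v} → Edge u v → Edge v u
  Edge-sym {u} {v} (u∈ , v∈ , h) = v∈ , u∈ , GAdj-sym {u} {v} h

  infix 4 _◁_
  -- On vertices of the graph: an edge, directed towards its larger label.
  _◁_ : Point → Point → Set
  u ◁ v = ℓ u < ℓ v × ¬ Precedes (ℓ u) (ℓ v) w

  letter : ∀ {u} → u ∈ S → ℓ u ∈ w
  letter {u} u∈ = proj₁ (proj₂ rep) u u∈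

  pattern⇔ : ∀ {u v} → u ∈ S → v ∈ S → ℓ u < ℓ v → (¬ GAdj u v) ⇔ Precedes (ℓ u) (ℓ v) w
  pattern⇔ {u} {v} u∈ v∈ l = mk⇔
    (λ h → Occ12⇒Precedes (subst₂ (Occ12 w) ⊓≡ ⊔≡ (Equivalence.to iff h)))
    (λ h → Equivalence.from iff (subst₂ (Occ12 w) (sym ⊓≡) (sym ⊔≡) (Precedes⇒Occ12 h)))
    where
    iff = proj₂ (proj₂ rep) u v u∈ v∈ λ { refl → ℕₚ.<-irrefl refl l }
    ⊓≡ = ℕₚ.m≤n⇒m⊓n≡m (ℕₚ.<⇒≤ l)
    ⊔≡ = ℕₚ.m≤n⇒m⊔n≡n (ℕₚ.<⇒≤ l)

  oriented : ∀ {u v} → Edge u v → u ◁ v ⊎ v ◁ u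
  oriented {u} {v} (u∈ , v∈ , h) with ℕₚ.<-cmp (ℓ u) (ℓ v)
  ... | tri< l _ _ = inj₁ (l , λ k → Equivalence.from (pattern⇔ u∈ v∈ l) k h)
  ... | tri≈ _ e _ = contradiction (proj₂ labeling u v u∈ v∈ e) (GAdj⇒≢ {u} {v} h)
  ... | tri> _ _ l = inj₂ (l , λ k → Equivalence.from (pattern⇔ v∈ u∈ l) k (GAdj-sym {u} {v} h))

  ◁⇒GAdj : ∀ {u v} → u ∈ S → v ∈ S → u ◁ v → GAdj u v
  ◁⇒GAdj {u} {v} u∈ v∈ (l , np) = decidable-stable (GAdj? u v) λ nadj → np (Equivalence.to (pattern⇔ u∈ v∈ l) nadj)

  -- Two consecutive arrows compose: labels increase, and by `precedes-split` a pattern for the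
  -- outer pair would give one for an edge. The composite would be the third side of a triangle.
  no-chain : ∀ {u v x} → Edge u v → Edge v x → u ◁ v → ¬ v ◁ x
  no-chain {u} {v} {x} (u∈ , v∈ , uv) (_ , x∈ , vx) (l , np) (l' , np') =
    no-triangle {u} {v} {x} uv vx (◁⇒GAdj u∈ x∈ (ℕₚ.<-trans l l' , λ h → split (precedes-split h (letter v∈))))
    where
    split : Precedes (ℓ u) (ℓ v) w ⊎ Precedes (ℓ v) (ℓ x) w → ⊥
    split (inj₁ h) = np h
    split (inj₂ h) = np' h

  -- Sources and sinks. By `no-chain` no vertex is both, so the type alternates along every edge.
  Low High : Point → Set
  Low u = ∃[ v ] (Edge u v × u ◁ v)
  High v = ∃[ u ] (Edge u v × u ◁ v)

  low-edge : ∀ {u v} → Low u → Edge u v → u ◁ v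
  low-edge (x , ux , h) e with oriented e
  ... | inj₁ k = k
  ... | inj₂ k = contradiction h (no-chain (Edge-sym e) ux k)

  high-edge : ∀ {u v} → High v → Edge u v → u ◁ v
  high-edge (x , xv , h) e with oriented e
  ... | inj₁ k = k
  ... | inj₂ k = contradiction k (no-chain xv (Edge-sym e) h)

  low-high : ∀ {u} → Low u → ¬ High u
  low-high (_ , uv , h) (_ , xu , k) = no-chain xu uv k h

  Opposite : Point → Point → Set
  Opposite u v = Low u × High v ⊎ High u × Low v

  opposite-edge : ∀ {u v} → Edge u v → Opposite u v
  opposite-edge e with oriented e
  ... | inj₁ h = inj₁ ((_ , e , h) , (_ , e , h))
  ... | inj₂ h = inj₂ ((_ , Edge-sym e , h) , (_ , Edge-sym e , h))

  opposite-step : ∀ {u v u' v'} → Opposite u v → Edge u u' → Edge v v' → Opposite u' v'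
  opposite-step (inj₁ (lu , hv)) e e' =
    inj₂ ((_ , e , low-edge lu e) , (_ , Edge-sym e' , high-edge hv (Edge-sym e')))
  opposite-step (inj₂ (hu , lv)) e e' =
    inj₁ ((_ , Edge-sym e , high-edge hu (Edge-sym e)) , (_ , e' , low-edge lv e'))

  -- A nonadjacent pair of a low u and a high v is witnessed by ℓ v < ℓ u or by
  -- the pattern; when uu', vv' induce 2K₂, the two nonadjacent pairs between
  -- them must have different witnesses.
  data Left (u v : Point) : Set where
    by-label   : Low u → High v → ℓ v < ℓ u → Left u v
    by-pattern : High u → Low v → Precedes (ℓ v) (ℓ u) w → Left u v

  -- These properties are symmetric in the two sides, so each contradiction is derived once and
  -- transferred by `flip-sides`. Asymmetry is not a field: a pair on both sides is refuted by
  -- moving one copy along two edges and applying `conflict`.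
  record Sides (R : Point → Point → Set) : Set where
    field
      opposite : ∀ {u v} → R u v → Opposite u v
      total : ∀ {u v} → u ∈ S → v ∈ S → Opposite u v → ¬ GAdj u v → R u v ⊎ R v u
      conflict : ∀ {u v u' v'} → Edge u u' → Edge v v' → R u v → ¬ R v' u'

    move : ∀ {u v u' v'} → R u v → Edge u u' → Edge v v' → ¬ GAdj u' v' → R u' v'
    move r e e' n with total (proj₁ (proj₂ e)) (proj₁ (proj₂ e')) (opposite-step (opposite r) e e') n
    ... | inj₁ h = h
    ... | inj₂ h = contradiction h (conflict e e' r)

  flip-sides : ∀ {R} → Sides R → Sides (λ u v → R v u)
  flip-sides s = record
    { opposite = λ r → Sum.swap (Sum.map Product.swap Product.swap (opposite r))
    ; total = λ u∈ v∈ o n → Sum.swap (total u∈ v∈ o n)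
    ; conflict = λ e e' r r' → conflict e' e r r'
    }
    where
    open Sides s

  left-sides : Sides Left
  left-sides = record { opposite = opposite ; total = total ; conflict = conflict }
    where
    opposite : ∀ {u v} → Left u v → Opposite u v
    opposite (by-label lu hv _) = inj₁ (lu , hv)
    opposite (by-pattern hu lv _) = inj₂ (hu , lv)
    compare : ∀ {u v} → u ∈ S → v ∈ S → Low u → High v → ¬ GAdj u v → Left u v ⊎ Left v u
    compare {u} {v} u∈ v∈ lu hv n with ℕₚ.<-cmp (ℓ u) (ℓ v)
    ... | tri< l _ _ = inj₂ (by-pattern hv lu (Equivalence.to (pattern⇔ u∈ v∈ l) n))
    ... | tri≈ _ e _ = contradiction (subst High (sym (proj₂ labeling u v u∈ v∈ e)) hv) (low-high lu)
    ... | tri> _ _ l = inj₁ (by-label lu hv l)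
    total : ∀ {u v} → u ∈ S → v ∈ S → Opposite u v → ¬ GAdj u v → Left u v ⊎ Left v u
    total u∈ v∈ (inj₁ (lu , hv)) n = compare u∈ v∈ lu hv n
    total {u} {v} u∈ v∈ (inj₂ (hu , lv)) n with compare v∈ u∈ lv hu (λ h → n (GAdj-sym {v} {u} h))
    ... | inj₁ h = inj₂ h
    ... | inj₂ h = inj₁ h
    conflict : ∀ {u v u' v'} → Edge u u' → Edge v v' → Left u v → ¬ Left v' u'
    -- The labels would run in a circle: `v` below `u` below `u'` below `v'` below `v`.
    conflict e e' (by-label lu hv l) (by-label lv' hu' l') =
      ℕₚ.<-irrefl refl (ℕₚ.<-trans (ℕₚ.<-trans l (proj₁ (low-edge lu e)))
        (ℕₚ.<-trans l' (proj₁ (low-edge lv' (Edge-sym e')))))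
    conflict e e' (by-label lu hv l) (by-pattern hv' lu' _) =
      low-high lu' (_ , e , low-edge lu e)
    conflict e e' (by-pattern hu lv p) (by-label lv' hu' _) =
      low-high lv' (_ , e' , low-edge lv e')
    -- Exchanging the two occurrences puts the low end of `uu'` or of `vv'` before its high end,
    -- which an edge forbids.
    conflict e e' (by-pattern hu lv p) (by-pattern hv' lu' p') with precedes-exchange p' p
    ... | inj₁ k = proj₂ (high-edge hu (Edge-sym e)) k
    ... | inj₂ k = proj₂ (low-edge lv e') k

  module _ (f : Fin 9 → Point) (f∈ : ∀ i → f i ∈ S)
    (adj : ∀ i j → i ≢ j → (Adj XGraph i j ⇔ GAdj (f i) (f j))) where

    X-edge : ∀ i j {_ : True (X-adj? i j)} {_ : True (¬? (i Fin.≟ j))} → Edge (f i) (f j)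
    X-edge i j {a} {ne} = f∈ i , f∈ j , Equivalence.to (adj i j (toWitness ne)) (toWitness a)

    X-nonedge : ∀ i j {_ : True (¬? (X-adj? i j))} {_ : True (¬? (i Fin.≟ j))} → ¬ GAdj (f i) (f j)
    X-nonedge i j {a} {ne} h = toWitness a (Equivalence.from (adj i j (toWitness ne)) h)

    -- The edges ab, de, hi form an asteroid: any two of them are joined by a
    -- path avoiding the neighbourhood of the third.
    X-one-side : ∀ {R} → Sides R → ¬ R (f (# 0)) (f (# 7))
    X-one-side {R} sides ah = case-ad (total (f∈ (# 0)) (f∈ (# 3)) opposite-ad (X-nonedge (# 0) (# 3)))
      where
      open Sides sides
      step : ∀ {i j} → R (f i) (f j) → ∀ i' j' {_ : True (X-adj? i i')} {_ : True (¬? (i Fin.≟ i'))}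
        {_ : True (X-adj? j j')} {_ : True (¬? (j Fin.≟ j'))}
        {_ : True (¬? (X-adj? i' j'))} {_ : True (¬? (i' Fin.≟ j'))} → R (f i') (f j')
      step {i} {j} r i' j' {a} {b} {c} {d} {e} {g} =
        move r (X-edge i i' {a} {b}) (X-edge j j' {c} {d}) (X-nonedge i' j' {e} {g})
      bi : R (f (# 1)) (f (# 8))
      bi = step ah (# 1) (# 8)
      di : R (f (# 3)) (f (# 8))
      di = step (step bi (# 2) (# 7)) (# 3) (# 8)
      opposite-ad : Opposite (f (# 0)) (f (# 3))
      opposite-ad = opposite-step (opposite-edge (X-edge (# 1) (# 2))) (X-edge (# 1) (# 0)) (X-edge (# 2) (# 3))
      case-ad : R (f (# 0)) (f (# 3)) ⊎ R (f (# 3)) (f (# 0)) → ⊥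
      -- The pair moves from `ad` through `be` and `gd` to `he`, which `di` excludes along the edges
      -- `de` and `ih`.
      case-ad (inj₁ ad) = conflict (X-edge (# 3) (# 4)) (X-edge (# 8) (# 7)) di
        (step (step (step ad (# 1) (# 4)) (# 6) (# 3)) (# 7) (# 4))
      -- Here `da` moves through `eb`, `fa` and `ib` to `ha`, the reverse of the given pair, which
      -- `bi` excludes.
      case-ad (inj₂ da) = conflict (X-edge (# 1) (# 0)) (X-edge (# 8) (# 7)) bi
        (step (step (step (step da (# 4) (# 1)) (# 5) (# 0)) (# 8) (# 1)) (# 7) (# 0))

    no-X : ⊥
    no-X with Sides.total left-sides (f∈ (# 0)) (f∈ (# 7))
      (opposite-step (opposite-edge (X-edge (# 1) (# 6))) (X-edge (# 1) (# 0)) (X-edge (# 6) (# 7)))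
      (X-nonedge (# 0) (# 7))
    ... | inj₁ h = X-one-side left-sides h
    ... | inj₂ h = X-one-side (flip-sides left-sides) h

  module _ (k : ℕ) (f : Fin (2 * (4 ℕ.+ k)) → Point) (f∈ : ∀ i → f i ∈ S)
    (adj : ∀ i j → i ≢ j → (Adj (Cycle (2 * (4 ℕ.+ k))) i j ⇔ GAdj (f i) (f j))) where

    M : ℕ
    M = 2 * (4 ℕ.+ k)

    -- Plain indices avoid arithmetic in `Fin`; the value from `M` on is a dummy, and wrapping round
    -- happens only in `v-closing`.
    v : ℕ → Point
    v i with i ℕ.<? M
    ... | yes l = f (fromℕ< l)
    ... | no _ = 𝟎

    v≡ : ∀ {i} (l : i < M) → v i ≡ f (fromℕ< l)
    v≡ {i} l with i ℕ.<? M
    ... | yes l' = cong (λ l → f (fromℕ< l)) (ℕₚ.<-irrelevant l' l)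
    ... | no ¬l = contradiction l ¬l

    v-adj⇔ : ∀ {i j} (l : i < M) (l' : j < M) → i ≢ j →
      Adj (Cycle M) (fromℕ< l) (fromℕ< l') ⇔ GAdj (v i) (v j)
    v-adj⇔ {i} {j} l l' ne = subst₂ (λ p q → Adj (Cycle M) (fromℕ< l) (fromℕ< l') ⇔ GAdj p q)
      (sym (v≡ l)) (sym (v≡ l')) (adj (fromℕ< l) (fromℕ< l') λ e → ne
        (trans (sym (Finₚ.toℕ-fromℕ< l)) (trans (cong toℕ e) (Finₚ.toℕ-fromℕ< l'))))

    v∈ : ∀ {i} → i < M → v i ∈ S
    v∈ l = subst (_∈ S) (sym (v≡ l)) (f∈ _)

    v-edge : ∀ {i} → suc i < M → Edge (v i) (v (suc i))
    v-edge {i} l = v∈ l' , v∈ l , Equivalence.to (v-adj⇔ l' l (ℕₚ.<⇒≢ (ℕₚ.n<1+n i)))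
      (inj₁ (inj₁ (trans (cong suc (Finₚ.toℕ-fromℕ< l')) (sym (Finₚ.toℕ-fromℕ< l)))))
      where
      l' : i < M
      l' = ℕₚ.<-trans (ℕₚ.n<1+n i) l

    v-closing : ∀ {i} → suc i ≡ M → Edge (v i) (v 0)
    v-closing {i} e = v∈ l , v∈ (s≤s z≤n) , Equivalence.to (v-adj⇔ l (s≤s z≤n) i≢0)
      (inj₁ (inj₂ (trans (cong suc (Finₚ.toℕ-fromℕ< l)) e , refl)))
      where
      l : i < M
      l = ℕₚ.≤-reflexive e
      i≢0 : i ≢ 0
      i≢0 refl = contradiction e λ ()

    v-nonedge : ∀ {i j} → suc i < j → j < M → (i ≡ 0 → suc j ≢ M) → ¬ GAdj (v i) (v j)
    v-nonedge {i} {j} i+1<j j<M open′ h = cases (Equivalence.from (v-adj⇔ i<M j<M (ℕₚ.<⇒≢ i<j)) h)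
      where
      i<j : i < j
      i<j = ℕₚ.<-trans (ℕₚ.n<1+n i) i+1<j
      i<M : i < M
      i<M = ℕₚ.<-trans i<j j<M
      cases : Adj (Cycle M) (fromℕ< i<M) (fromℕ< j<M) → ⊥
      cases rewrite Finₚ.toℕ-fromℕ< i<M | Finₚ.toℕ-fromℕ< j<M = λ
        { (inj₁ (inj₁ e)) → ℕₚ.<⇒≢ i+1<j e
        ; (inj₁ (inj₂ (_ , refl))) → ℕₚ.n≮0 i<j
        ; (inj₂ (inj₁ refl)) → ℕₚ.<-asym i<j (ℕₚ.n<1+n j)
        ; (inj₂ (inj₂ (e , z))) → open′ z e }

    first-< : ∀ {i} → i < 8 → i < M
    first-< l = ℕₚ.≤-trans l (ℕₚ.*-monoʳ-≤ 2 (ℕₚ.m≤m+n 4 k))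

    -- A pair at distance 3 is shifted until it is opposite to the closing edge,
    -- widened until it lies at distance 3 across that edge, and shifted over it,
    -- which returns to the initial pair with its sides exchanged.
    cycle-one-side : ∀ {R} → Sides R → ¬ R (v 0) (v 3)
    cycle-one-side {R} sides r = conflict (Edge-sym (v-edge (first-< 1<8))) (Edge-sym (v-edge (first-< 4<8)))
      (shift 1 r (first-< 4<8)) across
      where
      open Sides sides
      1<8 : 1 < 8
      1<8 = s≤s (s≤s z≤n)
      4<8 : 4 < 8
      4<8 = s≤s (s≤s (s≤s (s≤s (s≤s z≤n))))
      shift : ∀ i → R (v 0) (v 3) → i ℕ.+ 3 < M → R (v i) (v (i ℕ.+ 3))
      shift zero r _ = r
      shift (suc i) r l = move (shift i r (ℕₚ.<-trans (ℕₚ.n<1+n _) l))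
        (v-edge (ℕₚ.<-trans (s≤s (ℕₚ.m<m+n i (s≤s z≤n))) l)) (v-edge l)
        (v-nonedge (s≤s (subst (suc i <_) (ℕₚ.+-comm 3 i) (s≤s (ℕₚ.n≤1+n (suc i))))) l λ ())
      -- Both ends move outwards one step at a time; `1 ≤ a` keeps the left end off `v 0`, so no
      -- intermediate pair is joined by the closing edge.
      widen : ∀ d {a b} → R (v (d ℕ.+ a)) (v b) → 1 ≤ a → d ℕ.+ a < b → d ℕ.+ b < M → R (v a) (v (d ℕ.+ b))
      widen zero r _ _ _ = r
      widen (suc d) {a} {b} r 1≤a l l' = subst (λ j → R (v a) (v j)) (ℕₚ.+-suc d b)
        (widen d (move r (Edge-sym (v-edge (ℕₚ.<-trans l (ℕₚ.≤-<-trans (ℕₚ.m≤n+m b (suc d)) l')))) (v-edge b+1<M)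
          (v-nonedge (ℕₚ.<-trans l (ℕₚ.n<1+n b)) b+1<M
            λ e → contradiction (ℕₚ.≤-trans 1≤a (ℕₚ.m≤n+m a d)) (subst (λ z → ¬ 1 ≤ z) (sym e) λ ())))
          1≤a (ℕₚ.<-trans (ℕₚ.n<1+n _) (ℕₚ.<-trans l (ℕₚ.n<1+n b))) (subst (_< M) (sym (ℕₚ.+-suc d b)) l'))
        where
        b+1<M : suc b < M
        b+1<M = ℕₚ.≤-<-trans (s≤s (ℕₚ.m≤n+m b d)) l'
      -- With `i = k + 2` the indices `i` and `i + 3` add up to `M - 1`, so the pair is centred
      -- opposite the closing edge. Then `suc k` widenings lead to `1` and `e = M - 2`, at distance
      -- 3 across it.
      i e : ℕ
      i = suc k ℕ.+ 1
      e = suc k ℕ.+ (i ℕ.+ 3)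
      e+2≡M : suc (suc e) ≡ M
      e+2≡M = solve 1 (λ k → con 2 :+ ((con 1 :+ k) :+ ((con 1 :+ k) :+ con 1 :+ con 3)) := con 2 :* (con 4 :+ k)) refl k
        where open +-*-Solver
      e+1<M : suc e < M
      e+1<M = ℕₚ.≤-reflexive e+2≡M
      e<M : e < M
      e<M = ℕₚ.<-trans (ℕₚ.n<1+n e) e+1<M
      wide : R (v 1) (v e)
      wide = widen (suc k) (shift i r (ℕₚ.≤-<-trans (ℕₚ.m≤n+m (i ℕ.+ 3) (suc k)) e<M)) (s≤s z≤n)
        (ℕₚ.m<m+n i (s≤s z≤n)) e<M
      4≤e : 4 ≤ e
      4≤e = ℕₚ.≤-trans (ℕₚ.≤-trans (s≤s (ℕₚ.m≤n+m 3 (k ℕ.+ 1))) ℕₚ.≤-refl) (ℕₚ.m≤n+m (i ℕ.+ 3) (suc k))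
      across : R (v 3) (v 0)
      across = move (move wide (v-edge (first-< (s≤s (s≤s (s≤s z≤n))))) (v-edge e+1<M)
          (v-nonedge (ℕₚ.≤-trans 4≤e (ℕₚ.n≤1+n e)) e+1<M λ ()))
        (v-edge (first-< (s≤s (s≤s (s≤s (s≤s z≤n)))))) (v-closing e+2≡M)
        λ h → v-nonedge {0} {3} (s≤s (s≤s z≤n)) (first-< (s≤s (s≤s (s≤s (s≤s z≤n)))))
          (λ _ e → contradiction (first-< 4<8) (subst (λ z → ¬ 4 < z) e (ℕₚ.<-irrefl refl))) (GAdj-sym {v 3} {v 0} h)

    no-cycle : ⊥
    no-cycle with Sides.total left-sides (v∈ (s≤s z≤n)) (v∈ 3<M)
      (opposite-step (opposite-edge (v-edge 2<M)) (Edge-sym (v-edge (ℕₚ.<-trans (s≤s (s≤s z≤n)) 2<M))) (v-edge 3<M))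
      (v-nonedge (s≤s (s≤s z≤n)) 3<M λ _ e → contradiction (first-< (s≤s (s≤s (s≤s (s≤s (s≤s z≤n))))))
        (subst (λ z → ¬ 4 < z) e (ℕₚ.<-irrefl refl)))
      where
      2<M : 2 < M
      2<M = first-< (s≤s (s≤s (s≤s z≤n)))
      3<M : 3 < M
      3<M = first-< (s≤s (s≤s (s≤s (s≤s z≤n))))
    ... | inj₁ h = cycle-one-side left-sides h
    ... | inj₂ h = cycle-one-side (flip-sides left-sides) h

representable⇒avoiding : ∀ S → TwelveRepresentable S → FAvoiding S
representable⇒avoiding S (ℓ , labeling , w , rep) =
  (λ (f , f∈ , _ , adj) → no-X f f∈ adj) , no-cycles
  where
  open Representation S ℓ labeling w rep
  no-cycles : ∀ n → 4 ≤ n → ¬ ContainsInduced S (Cycle (2 * n))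
  no-cycles (suc (suc (suc (suc k)))) (s≤s (s≤s (s≤s (s≤s z≤n)))) (f , f∈ , _ , adj) = no-cycle k f f∈ adj

theorem18 : (S : List Point) → SquareGridGraph S →
    (FAvoiding S ⇔ TwelveRepresentable S)
theorem18 S grid = mk⇔ (avoiding⇒representable S grid) (representable⇒avoiding S)
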